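{- For all $n\ge1$ and all $s$, $$\ddot H_n\Bigl(\frac{\cos x+\sin x}{(\cos x-\sin x)^{s}}\Bigr) =4^{\binom n2}\Bigl(\prod_{k=1}^{n-1}k!\Bigr) \prod_{j=0}^{n-2}\bigl[(s+2j)(s+2j+1)\bigr]^{\,n-1-j}.$$
   Context: For a formal power series $f(x)=\sum_{k\ge0}a_kx^k/k!$ in $x$, the dilated Hankel determinant is $\ddot H_n(f)=\det(a_{2i+j})_{0\le i,j\le n-1}$. Here $s$ is a parameter and $(\cos x-\sin x)^{ -s}$ is expanded as the power series in $x$ with constant term $1$, its coefficients being polynomials in $s$. Empty products equal $1$. -}

module Defs where

open import Algebra.Bundles using (CommutativeRing; module Semiring)
open import Algebra.Morphism.Structures using (module RingMorphisms)
import Algebra.Definitions.RawSemiring as RawSemiringDefinitions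
open import Data.Fin.Base using (Fin; zero; suc; toℕ; punchIn)
open import Data.Integer.Base using (+_)
open import Data.Nat.Base as ℕ using (ℕ; zero; suc; _∸_; _!)
open import Data.Nat.Properties using (_!≢0)
open import Data.Rational.Base as ℚ using (ℚ)
open import Level using (Level; _⊔_) renaming (suc to lsuc)

record ℚ-Algebra (c ℓ : Level) : Set (lsuc (c ⊔ ℓ)) where
  field
    commutativeRing : CommutativeRing c ℓ

  open CommutativeRing commutativeRing public hiding (zero)

  field
    ι                  : ℚ → Carrier
    isRingHomomorphism : RingMorphisms.IsRingHomomorphism ℚ.+-*-rawRing rawRing ι

module PowerSeries {c ℓ : Level} (A : ℚ-Algebra c ℓ) where

  open ℚ-Algebra A public
  open RawSemiringDefinitions (Semiring.rawSemiring semiring) public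
    using (_×_; _^_; sum; product)

  1/_! : ℕ → Carrier
  1/ k ! = ι (ℚ._/_ (+ 1) (k !) {{k !≢0}})

  -- A series is the sequence of its ordinary coefficients: f k = [xᵏ] f.
  Series : Set c
  Series = ℕ → Carrier

  infixl 6 _+ₛ_ _-ₛ_
  infixl 7 _*ₛ_
  infixr 8 _^ₛ_ _^^_

  1ₛ : Series
  1ₛ zero    = 1#
  1ₛ (suc _) = 0#

  _+ₛ_ : Series → Series → Series
  (f +ₛ g) k = f k + g k

  _-ₛ_ : Series → Series → Series
  (f -ₛ g) k = f k - g k

  _*ₛ_ : Series → Series → Series
  (f *ₛ g) k = sum {suc k} λ i → f (toℕ i) * g (k ∸ toℕ i)

  _^ₛ_ : Series → ℕ → Series
  f ^ₛ zero  = 1ₛ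
  f ^ₛ suc m = f *ₛ f ^ₛ m

  falling : Carrier → ℕ → Carrier
  falling t zero    = 1#
  falling t (suc m) = falling t m * (t - m × 1#)

  binomial : Carrier → ℕ → Carrier
  binomial t m = 1/ m ! * falling t m

  -- Binomial series hᵗ = Σₘ binomial t m (h - 1)ᵐ, meaningful only when h has
  -- constant term 1.  In that case (h - 1)ᵐ has no terms of degree below m, so
  -- only m ≤ k contribute to the coefficient of xᵏ.
  _^^_ : Series → Carrier → Series
  (h ^^ t) k = sum {suc k} λ m → binomial t (toℕ m) * ((h -ₛ 1ₛ) ^ₛ toℕ m) k

  -- The k-th derivatives of cos and sin at 0.
  cos⁽_⁾0 : ℕ → Carrier
  cos⁽ 0 ⁾0           = 1#
  cos⁽ 1 ⁾0           = 0#
  cos⁽ suc (suc k) ⁾0 = - cos⁽ k ⁾0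

  sin⁽_⁾0 : ℕ → Carrier
  sin⁽ 0 ⁾0           = 0#
  sin⁽ 1 ⁾0           = 1#
  sin⁽ suc (suc k) ⁾0 = - sin⁽ k ⁾0

  cosₛ : Series
  cosₛ k = 1/ k ! * cos⁽ k ⁾0

  sinₛ : Series
  sinₛ k = 1/ k ! * sin⁽ k ⁾0

  -- The aₖ in f(x) = Σₖ aₖ xᵏ / k!.
  egfCoeff : Series → ℕ → Carrier
  egfCoeff f k = (k !) × f k

  Matrix : ℕ → Set c
  Matrix n = Fin n → Fin n → Carrier

  -- Laplace expansion along the first row.
  det : ∀ {n} → Matrix n → Carrier
  det {zero}  M = 1#
  det {suc n} M =
    sum λ j → (- 1#) ^ toℕ j * (M zero j * det (λ i k → M (suc i) (punchIn j k)))

  dilatedHankel : ℕ → Series → Carrier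
  dilatedHankel n f = det {n} λ i j → egfCoeff f (2 ℕ.* toℕ i ℕ.+ toℕ j)

{-# OPTIONS --safe #-}
module Submission where

-- Write u = cos - sin, v = cos + sin and F_k = v u^(-s-2k), so that F_0 is the given series.
-- From u' = -v, v' = u and u² + v² = 2 one gets
--   F_k'' = -(s+2k-1)² F_k + 2 (s+2k)(s+2k+1) F_{k+1},
-- so row i of the dilated Hankel matrix, the derivatives at 0 of F_0^(2i), is a combination
-- of those of F_0, …, F_i.  With q = 1 - u² = 2x + ⋯, the p-th difference of F_k in k is
-- q^p v u^(-s-2k-2p), which has order p and leading coefficient 2^p.  By Newton's formula the
-- matrix is therefore a product LU, with diagonal entries
--   L_mm = ∏_{l<m} 2 (s+2l)(s+2l+1)  and  U_mm = 2^m m!.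

open import Defs
open import Algebra.Bundles using (CommutativeRing)
open import Algebra.Morphism.Structures using (module RingMorphisms)
open import Algebra.Solver.Ring.AlmostCommutativeRing using (fromCommutativeRing; _-Raw-AlmostCommutative⟶_)
import Algebra.Properties.CommutativeMonoid.Mult
import Algebra.Properties.CommutativeMonoid.Sum
import Algebra.Properties.CommutativeSemiring.Exp
import Algebra.Properties.Ring
import Algebra.Properties.Semiring.Exp
import Algebra.Properties.Semiring.Mult
import Algebra.Properties.Semiring.Sum
import Algebra.Solver.Ring
open import Data.Fin.Base using (Fin; zero; suc; toℕ; punchIn)
open import Data.Fin.Properties using (toℕ<n)
open import Data.Integer.Base as ℤ using (+_)
import Data.Integer.Properties as ℤ
open import Data.List.Base using (List; []; _∷_; _++_; tabulate)
open import Data.List.Relation.Binary.Pointwise using (Pointwise; []; _∷_)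
import Data.List.Relation.Binary.Pointwise as Pointwise
open import Data.List.Relation.Unary.All using (All; []; _∷_)
import Data.List.Relation.Unary.All.Properties as All
open import Data.Maybe.Base as Maybe using (Maybe)
open import Data.Nat.Base as ℕ using (ℕ; zero; suc; _∸_; _≥_; _≤_; _<_; z≤n; s≤s; _!)
open import Data.Nat.Combinatorics using (_C_; nCk+nC[k+1]≡[n+1]C[k+1]; nC1≡n)
import Data.Nat.Properties as ℕ
open import Data.Product.Base using (∃; _,_)
open import Data.Rational.Base as ℚ using (ℚ; mkℚ; 0ℚ; 1ℚ)
import Data.Rational.Properties as ℚ
import Data.Rational.Unnormalised.Base as ℚᵘ
import Data.Rational.Unnormalised.Properties as ℚᵘ
open import Function.Base using (_∘_)
open import Level using (Level; _⊔_)
import Relation.Binary.Reasoning.Setoid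
open import Relation.Binary.PropositionalEquality.Core as ≡ using (_≡_)
open import Relation.Nullary.Decidable.Core using (dec⇒maybe)

-- The recurrence acts on the index k alone and the extraction of coefficients on the column alone,
-- so Newton's expansion F_k = Σ_m C(k,m) Δ^m F_0 separates every matrix entry into a factor of the
-- row and a factor of the column. The row factor is the recurrence iterated i times on k ↦ C(k,m):
-- i steps from k = 0 see only k ≤ i, where C(k,m) vanishes if i < m. The step of two between rows
-- is what fits: one derivative turns `v` times a power of `u` into powers of `u` without `v`, a
-- second one brings `v` back. Since `s` is an element of an arbitrary commutative ℚ-algebra, the
-- factors (s+2l)(s+2l+1) cannot be assumed invertible or cancellable. Hence powers of `u` are
-- binomial series whose exponent is a ring element, handled through their constant term, their
-- derivative and the rule `E (t + 1#) ≋ u *ₛ E t`, and elimination subtracts multiples of columns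
-- but never divides.

-- Ring solving with rational constants.

module ℚ-Solver {c ℓ : Level} (A : ℚ-Algebra c ℓ) where
  open ℚ-Algebra A
  private module ι = RingMorphisms.IsRingHomomorphism isRingHomomorphism

  -- Agrees with ι, but makes the solver's constants 0 and 1 denote 0# and 1#.
  embed : ℚ → Carrier
  embed (mkℚ (+ 0) 0 _) = 0#
  embed (mkℚ (+ 1) 0 _) = 1#
  embed q               = ι q

  embed≈ι : ∀ q → embed q ≈ ι q
  embed≈ι (mkℚ (+ 0) 0 _)               = sym ι.0#-homo
  embed≈ι (mkℚ (+ 1) 0 _)               = sym ι.1#-homo
  embed≈ι (mkℚ (+ suc (suc _)) _ _)     = refl
  embed≈ι (mkℚ (+ 0) (suc _) _)         = refl
  embed≈ι (mkℚ (+ 1) (suc _) _)         = refl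
  embed≈ι (mkℚ ℤ.-[1+ _ ] _ _)           = refl

  embedding : ℚ.+-*-rawRing -Raw-AlmostCommutative⟶ fromCommutativeRing commutativeRing
  embedding = record
    { ⟦_⟧    = embed
    ; +-homo = λ p q → trans (embed≈ι _) (trans (ι.+-homo p q) (sym (+-cong (embed≈ι p) (embed≈ι q))))
    ; *-homo = λ p q → trans (embed≈ι _) (trans (ι.*-homo p q) (sym (*-cong (embed≈ι p) (embed≈ι q))))
    ; -‿homo = λ p → trans (embed≈ι _) (trans (ι.-‿homo p) (sym (-‿cong (embed≈ι p))))
    ; 0-homo = refl
    ; 1-homo = refl
    }

  embed-≟ : ∀ p q → Maybe (embed p ≈ embed q)
  embed-≟ p q = Maybe.map (reflexive ∘ ≡.cong embed) (dec⇒maybe (p ℚ.≟ q))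

  open Algebra.Solver.Ring ℚ.+-*-rawRing (fromCommutativeRing commutativeRing) embedding embed-≟
    public using (Polynomial; solve; _:=_; _:+_; _:*_; _:-_; :-_; con)

  :0 :1 : ∀ {n} → Polynomial n
  :0 = con 0ℚ
  :1 = con 1ℚ

-- The ring of formal power series.

module SeriesRing {c ℓ : Level} (A : ℚ-Algebra c ℓ) where
  open PowerSeries A
  open ℚ-Solver A
  open Relation.Binary.Reasoning.Setoid setoid
  open Algebra.Properties.Ring ring using (-0#≈0#)
  private module ι = RingMorphisms.IsRingHomomorphism isRingHomomorphism

  infix 4 _≋_
  _≋_ : Series → Series → Set ℓ
  f ≋ g = ∀ k → f k ≈ g k

  tail : Series → Series
  tail f k = f (suc k)

  const : Carrier → Series
  const x zero    = x
  const x (suc _) = 0#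

  0ₛ : Series
  0ₛ _ = 0#

  -ₛ_ : Series → Series
  (-ₛ f) k = - f k

  infixr 7 _·_
  _·_ : Carrier → Series → Series
  (x · f) k = x * f k

  -- Degree k of a product reads only degrees up to k. The bounded form is needed because `comp`
  -- truncates its sum according to the degree, so that a sum with a fixed bound agrees with it only
  -- up to that bound.
  *ₛ-cong-≤ : ∀ {f f′ g g′} k → (∀ {i} → i ≤ k → f i ≈ f′ i) → (∀ {i} → i ≤ k → g i ≈ g′ i) →
              (f *ₛ g) k ≈ (f′ *ₛ g′) k
  *ₛ-cong-≤ zero    f≈ g≈ = +-congʳ (*-cong (f≈ z≤n) (g≈ z≤n))
  *ₛ-cong-≤ (suc k) f≈ g≈ =
    +-cong (*-cong (f≈ z≤n) (g≈ ℕ.≤-refl)) (*ₛ-cong-≤ k (f≈ ∘ s≤s) (g≈ ∘ ℕ.m≤n⇒m≤1+n))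

  *ₛ-congˡ-≤ : ∀ f g g′ k → (∀ {i} → i ≤ k → g i ≈ g′ i) → (f *ₛ g) k ≈ (f *ₛ g′) k
  *ₛ-congˡ-≤ f g g′ k g≈ = *ₛ-cong-≤ {f} {f} {g} {g′} k (λ _ → refl) g≈

  *ₛ-cong : ∀ {f f′ g g′} → f ≋ f′ → g ≋ g′ → f *ₛ g ≋ f′ *ₛ g′
  *ₛ-cong f≋ g≋ k = *ₛ-cong-≤ k (λ {i} _ → f≋ i) (λ {i} _ → g≋ i)

  *ₛ-zeroˡ : ∀ g → 0ₛ *ₛ g ≋ 0ₛ
  *ₛ-zeroˡ g zero    = solve 1 (λ x → :0 :* x :+ :0 := :0) refl (g 0)
  *ₛ-zeroˡ g (suc k) = trans (+-cong (zeroˡ _) (*ₛ-zeroˡ g k)) (+-identityˡ 0#)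

  const-*ₛ : ∀ x g → const x *ₛ g ≋ x · g
  const-*ₛ x g zero    = +-identityʳ _
  const-*ₛ x g (suc k) = trans (+-congˡ (*ₛ-zeroˡ g k)) (+-identityʳ _)

  const-1 : const 1# ≋ 1ₛ
  const-1 zero    = refl
  const-1 (suc _) = refl

  *ₛ-identityˡ : ∀ g → 1ₛ *ₛ g ≋ g
  *ₛ-identityˡ g k = begin
    (1ₛ *ₛ g) k        ≈⟨ *ₛ-cong {g = g} (λ i → sym (const-1 i)) (λ _ → refl) k ⟩
    (const 1# *ₛ g) k  ≈⟨ const-*ₛ 1# g k ⟩
    1# * g k           ≈⟨ *-identityˡ _ ⟩
    g k                ∎

  -- Unfolding the product splits off the first coefficient of the left factor; this is the mirror
  -- image for the right factor, and commutativity compares the two.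
  *ₛ-suc : ∀ f g k → (f *ₛ g) (suc k) ≈ f (suc k) * g 0 + (f *ₛ tail g) k
  *ₛ-suc f g zero = solve 4 (λ a b c d → a :* d :+ (b :* c :+ :0) := b :* c :+ (a :* d :+ :0))
    refl (f 0) (f 1) (g 0) (g 1)
  *ₛ-suc f g (suc k) = begin
    f 0 * g (2 ℕ.+ k) + (tail f *ₛ g) (suc k)
      ≈⟨ +-congˡ (*ₛ-suc (tail f) g k) ⟩
    f 0 * g (2 ℕ.+ k) + (f (2 ℕ.+ k) * g 0 + (tail f *ₛ tail g) k)
      ≈⟨ solve 3 (λ x y z → x :+ (y :+ z) := y :+ (x :+ z)) refl _ _ _ ⟩
    f (2 ℕ.+ k) * g 0 + (f 0 * g (2 ℕ.+ k) + (tail f *ₛ tail g) k) ∎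

  *ₛ-comm : ∀ f g → f *ₛ g ≋ g *ₛ f
  *ₛ-comm f g zero    = +-congʳ (*-comm _ _)
  *ₛ-comm f g (suc k) = begin
    f 0 * g (suc k) + (tail f *ₛ g) k  ≈⟨ +-cong (*-comm _ _) (*ₛ-comm (tail f) g k) ⟩
    g (suc k) * f 0 + (g *ₛ tail f) k  ≈⟨ *ₛ-suc g f k ⟨
    (g *ₛ f) (suc k)                   ∎

  *ₛ-distribʳ : ∀ h f g → (f +ₛ g) *ₛ h ≋ f *ₛ h +ₛ g *ₛ h
  *ₛ-distribʳ h f g zero =
    solve 3 (λ x y z → (x :+ y) :* z :+ :0 := x :* z :+ :0 :+ (y :* z :+ :0)) refl _ _ _
  *ₛ-distribʳ h f g (suc k) = trans (+-congˡ (*ₛ-distribʳ h (tail f) (tail g) k))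
    (solve 5 (λ x y z a b → (x :+ y) :* z :+ (a :+ b) := x :* z :+ a :+ (y :* z :+ b)) refl _ _ _ _ _)

  *ₛ-distribˡ : ∀ h f g → h *ₛ (f +ₛ g) ≋ h *ₛ f +ₛ h *ₛ g
  *ₛ-distribˡ h f g k = begin
    (h *ₛ (f +ₛ g)) k          ≈⟨ *ₛ-comm h (f +ₛ g) k ⟩
    ((f +ₛ g) *ₛ h) k          ≈⟨ *ₛ-distribʳ h f g k ⟩
    (f *ₛ h) k + (g *ₛ h) k    ≈⟨ +-cong (*ₛ-comm f h k) (*ₛ-comm g h k) ⟩
    (h *ₛ f +ₛ h *ₛ g) k       ∎

  ·-*ₛ : ∀ x f g → (x · f) *ₛ g ≋ x · (f *ₛ g)
  ·-*ₛ x f g zero =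
    solve 3 (λ x y z → x :* y :* z :+ :0 := x :* (y :* z :+ :0)) refl _ _ _
  ·-*ₛ x f g (suc k) = trans (+-congˡ (·-*ₛ x (tail f) g k))
    (solve 4 (λ x y z a → x :* y :* z :+ x :* a := x :* (y :* z :+ a)) refl _ _ _ _)

  *ₛ-assoc : ∀ f g h → (f *ₛ g) *ₛ h ≋ f *ₛ (g *ₛ h)
  *ₛ-assoc f g h zero =
    solve 3 (λ x y z → (x :* y :+ :0) :* z :+ :0 := x :* (y :* z :+ :0) :+ :0) refl _ _ _
  *ₛ-assoc f g h (suc k) = begin
    -- By computation `tail (f *ₛ g)` is `f 0 · tail g +ₛ tail f *ₛ g`.
    (f 0 * g 0 + 0#) * h (suc k) + ((f 0 · tail g +ₛ tail f *ₛ g) *ₛ h) k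
      ≈⟨ +-congˡ (*ₛ-distribʳ h (f 0 · tail g) (tail f *ₛ g) k) ⟩
    (f 0 * g 0 + 0#) * h (suc k) + (((f 0 · tail g) *ₛ h) k + ((tail f *ₛ g) *ₛ h) k)
      ≈⟨ +-congˡ (+-cong (·-*ₛ (f 0) (tail g) h k) (*ₛ-assoc (tail f) g h k)) ⟩
    (f 0 * g 0 + 0#) * h (suc k) + (f 0 * (tail g *ₛ h) k + (tail f *ₛ (g *ₛ h)) k)
      ≈⟨ solve 5 (λ x y z a b → (x :* y :+ :0) :* z :+ (x :* a :+ b) := x :* (y :* z :+ a) :+ b)
           refl _ _ _ _ _ ⟩
    f 0 * (g 0 * h (suc k) + (tail g *ₛ h) k) + (tail f *ₛ (g *ₛ h)) k ∎

  seriesRing : CommutativeRing c ℓ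
  seriesRing = record
    { Carrier = Series
    ; _≈_ = _≋_
    ; _+_ = _+ₛ_
    ; _*_ = _*ₛ_
    ; -_  = -ₛ_
    ; 0#  = 0ₛ
    ; 1#  = 1ₛ
    ; isCommutativeRing = record
      { isRing = record
        { +-isAbelianGroup = record
          { isGroup = record
            { isMonoid = record
              { isSemigroup = record
                { isMagma = record
                  { isEquivalence = record
                    { refl  = λ _ → refl
                    ; sym   = λ e k → sym (e k)
                    ; trans = λ e e′ k → trans (e k) (e′ k)
                    }
                  ; ∙-cong = λ e e′ k → +-cong (e k) (e′ k)
                  }
                ; assoc = λ f g h k → +-assoc _ _ _
                }
              ; identity = (λ f k → +-identityˡ _) , (λ f k → +-identityʳ _)
              }
            ; inverse = (λ f k → -‿inverseˡ _) , (λ f k → -‿inverseʳ _)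
            ; ⁻¹-cong = λ e k → -‿cong (e k)
            }
          ; comm = λ f g k → +-comm _ _
          }
        ; *-cong = *ₛ-cong
        ; *-assoc = *ₛ-assoc
        ; *-identity = *ₛ-identityˡ , λ f k → trans (*ₛ-comm f 1ₛ k) (*ₛ-identityˡ f k)
        ; distrib = *ₛ-distribˡ , *ₛ-distribʳ
        }
      ; *-comm = *ₛ-comm
      }
    }

  const-cong : ∀ {x y} → x ≈ y → const x ≋ const y
  const-cong x≈y zero    = x≈y
  const-cong x≈y (suc _) = refl

  const-+ : ∀ x y → const (x + y) ≋ const x +ₛ const y
  const-+ x y zero    = refl
  const-+ x y (suc _) = sym (+-identityˡ 0#)

  const-* : ∀ x y → const (x * y) ≋ const x *ₛ const y
  const-* x y zero    = sym (+-identityʳ _)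
  const-* x y (suc k) = sym (trans (const-*ₛ x (const y) (suc k)) (zeroʳ x))

  const-neg : ∀ x → const (- x) ≋ -ₛ const x
  const-neg x zero    = refl
  const-neg x (suc _) = sym -0#≈0#

  private module ⊛ = CommutativeRing seriesRing

  -- Makes the ring solver available for identities between whole series.
  seriesAlgebra : ℚ-Algebra c ℓ
  seriesAlgebra = record
    { commutativeRing = seriesRing
    ; ι = const ∘ ι
    ; isRingHomomorphism = record
      { isSemiringHomomorphism = record
        { isNearSemiringHomomorphism = record
          { +-isMonoidHomomorphism = record
            { isMagmaHomomorphism = record
              { isRelHomomorphism = record { cong = const-cong ∘ ι.⟦⟧-cong }
              ; homo = λ p q → ⊛.trans (const-cong (ι.+-homo p q)) (const-+ (ι p) (ι q))
              }
            ; ε-homo = ⊛.trans (const-cong ι.0#-homo) (λ { zero → refl ; (suc _) → refl })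
            }
          ; *-homo = λ p q → ⊛.trans (const-cong (ι.*-homo p q)) (const-* (ι p) (ι q))
          }
        ; 1#-homo = ⊛.trans (const-cong ι.1#-homo) const-1
        }
      ; -‿homo = λ p → ⊛.trans (const-cong (ι.-‿homo p)) (const-neg (ι p))
      }
    }

-- Unit fractions, formal differentiation and composition of series.

suc/ : ∀ n d → + suc n ℚ./ suc d ≡ + 1 ℚ./ suc d ℚ.+ + n ℚ./ suc d
suc/ n d = ℚ.toℚᵘ-injective (begin
  ℚ.toℚᵘ (+ suc n ℚ./ suc d)
    ≈⟨ ℚ.toℚᵘ-fromℚᵘ (ℚᵘ.mkℚᵘ (+ suc n) d) ⟩
  ℚᵘ.mkℚᵘ (+ suc n) d
    ≈⟨ ℚᵘ.*≡* (≡.trans (≡.sym (ℤ.*-assoc (+ suc n) (+ suc d) (+ suc d)))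
         (≡.cong (ℤ._* + suc d) (ℤ.*-distribʳ-+ (+ suc d) (+ 1) (+ n)))) ⟩
  ℚᵘ.mkℚᵘ (+ 1) d ℚᵘ.+ ℚᵘ.mkℚᵘ (+ n) d
    ≈⟨ ℚᵘ.+-cong (ℚ.toℚᵘ-fromℚᵘ (ℚᵘ.mkℚᵘ (+ 1) d)) (ℚ.toℚᵘ-fromℚᵘ (ℚᵘ.mkℚᵘ (+ n) d)) ⟨
  ℚ.toℚᵘ (+ 1 ℚ./ suc d) ℚᵘ.+ ℚ.toℚᵘ (+ n ℚ./ suc d)
    ≈⟨ ℚ.toℚᵘ-homo-+ (+ 1 ℚ./ suc d) (+ n ℚ./ suc d) ⟨
  ℚ.toℚᵘ (+ 1 ℚ./ suc d ℚ.+ + n ℚ./ suc d) ∎)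
  where open Relation.Binary.Reasoning.Setoid ℚᵘ.≃-setoid

suc/suc : ∀ d → + suc d ℚ./ suc d ≡ 1ℚ
suc/suc d = ℚ.fromℚᵘ-cong {ℚᵘ.mkℚᵘ (+ suc d) d} {ℚᵘ.1ℚᵘ}
  (ℚᵘ.*≡* (ℤ.*-comm (+ suc d) (+ 1)))

module Calculus {c ℓ : Level} (A : ℚ-Algebra c ℓ) where
  open PowerSeries A
  open ℚ-Solver A
  open SeriesRing A
  open Relation.Binary.Reasoning.Setoid setoid
  open Algebra.Properties.Semiring.Sum semiring
    using (sum-cong-≋; sum-replicate-zero; ∑-distrib-+; *-distribˡ-sum)
  open Algebra.Properties.Semiring.Mult semiring
    using (×-congʳ; ×-comm-*; ×-assoc-*; ×-assocˡ)
  open Algebra.Properties.CommutativeMonoid.Mult +-commutativeMonoid using (×-distrib-+)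
  private
    module ι = RingMorphisms.IsRingHomomorphism isRingHomomorphism
    module ⊛ = CommutativeRing seriesRing
    module ⊛S = ℚ-Solver seriesAlgebra

  ι-/ : ∀ n d → ι (+ n ℚ./ suc d) ≈ n × ι (+ 1 ℚ./ suc d)
  ι-/ zero    d = trans (ι.⟦⟧-cong (ℚ.0/n≡0 (suc d))) ι.0#-homo
  ι-/ (suc n) d = begin
    ι (+ suc n ℚ./ suc d)                       ≈⟨ ι.⟦⟧-cong (suc/ n d) ⟩
    ι (+ 1 ℚ./ suc d ℚ.+ + n ℚ./ suc d)         ≈⟨ ι.+-homo _ _ ⟩
    ι (+ 1 ℚ./ suc d) + ι (+ n ℚ./ suc d)       ≈⟨ +-congˡ (ι-/ n d) ⟩
    suc n × ι (+ 1 ℚ./ suc d)                   ∎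

  n×1/n : ∀ n .{{_ : ℕ.NonZero n}} → n × ι (+ 1 ℚ./ n) ≈ 1#
  n×1/n (suc d) = begin
    suc d × ι (+ 1 ℚ./ suc d)  ≈⟨ ι-/ (suc d) d ⟨
    ι (+ suc d ℚ./ suc d)      ≈⟨ ι.⟦⟧-cong (suc/suc d) ⟩
    ι 1ℚ                       ≈⟨ ι.1#-homo ⟩
    1#                         ∎

  -- Multiply by the image of 1/(n+1). This is how the rational scalars make a series with zero
  -- derivative constant.
  ×-torsionfree : ∀ n x → suc n × x ≈ 0# → x ≈ 0#
  ×-torsionfree n x nx≈0 = begin
    x                    ≈⟨ *-identityʳ x ⟨
    x * 1#               ≈⟨ *-congˡ (n×1/n (suc n)) ⟨
    x * (suc n × r)      ≈⟨ ×-comm-* (suc n) x r ⟩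
    suc n × (x * r)      ≈⟨ ×-assoc-* (suc n) x r ⟨
    (suc n × x) * r      ≈⟨ *-congʳ nx≈0 ⟩
    0# * r               ≈⟨ zeroˡ r ⟩
    0#                   ∎
    where r = ι (+ 1 ℚ./ suc n)

  k!×1/k! : ∀ k → (k !) × 1/ k ! ≈ 1#
  k!×1/k! k = n×1/n (k !) {{k ℕ.!≢0}}

  suc×1/suc! : ∀ k → suc k × 1/ suc k ! ≈ 1/ k !
  suc×1/suc! k = begin
    suc k × r                       ≈⟨ *-identityʳ _ ⟨
    (suc k × r) * 1#                ≈⟨ *-congˡ (k!×1/k! k) ⟨
    (suc k × r) * ((k !) × r′)      ≈⟨ ×-comm-* (k !) _ _ ⟩
    (k !) × ((suc k × r) * r′)      ≈⟨ ×-assoc-* (k !) _ _ ⟨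
    ((k !) × (suc k × r)) * r′      ≈⟨ *-congʳ (×-assocˡ r (k !) (suc k)) ⟩
    ((k ! ℕ.* suc k) × r) * r′      ≡⟨ ≡.cong (λ m → (m × r) * r′) (ℕ.*-comm (k !) (suc k)) ⟩
    ((suc k !) × r) * r′            ≈⟨ *-congʳ (k!×1/k! (suc k)) ⟩
    1# * r′                         ≈⟨ *-identityˡ r′ ⟩
    r′                              ∎
    where r = 1/ suc k ! ; r′ = 1/ k !

  ∂ : Series → Series
  ∂ f k = suc k × f (suc k)

  ∂-cong : ∀ {f g} → f ≋ g → ∂ f ≋ ∂ g
  ∂-cong f≋g k = ×-congʳ (suc k) (f≋g (suc k))

  ∂-+ : ∀ f g → ∂ (f +ₛ g) ≋ ∂ f +ₛ ∂ g
  ∂-+ f g k = ×-distrib-+ (f (suc k)) (g (suc k)) (suc k)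

  ×0# : ∀ n → n × 0# ≈ 0#
  ×0# zero    = refl
  ×0# (suc n) = trans (+-identityˡ _) (×0# n)

  ∂-const : ∀ x → ∂ (const x) ≋ 0ₛ
  ∂-const x k = ×0# (suc k)

  ∂-* : ∀ f g → ∂ (f *ₛ g) ≋ ∂ f *ₛ g +ₛ f *ₛ ∂ g
  ∂-* f g zero = solve 4
    (λ a b c d → a :* d :+ (b :* c :+ :0) :+ :0 := (b :+ :0) :* c :+ :0 :+ (a :* (d :+ :0) :+ :0))
    refl (f 0) (f 1) (g 0) (g 1)
  ∂-* f g (suc k) = begin
    (2 ℕ.+ k) × (f 0 * g (2 ℕ.+ k) + B)
      ≈⟨ ×-distrib-+ _ B (2 ℕ.+ k) ⟩
    -- One copy of `B` is split off; the remaining 1 + k copies are a derivative in degree k, to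
    -- which the induction hypothesis applies.
    (2 ℕ.+ k) × (f 0 * g (2 ℕ.+ k)) + (B + ∂ (tail f *ₛ g) k)
      ≈⟨ +-cong (sym (×-comm-* (2 ℕ.+ k) (f 0) (g (2 ℕ.+ k)))) (+-congˡ (∂-* (tail f) g k)) ⟩
    f 0 * ∂ g (suc k) + (B + ((∂ (tail f) *ₛ g) k + (tail f *ₛ ∂ g) k))
      ≈⟨ solve 6 (λ a x y b c d → a :+ (x :* y :+ b :+ (c :+ d)) := ((x :+ :0) :* y :+ (b :+ c)) :+ (a :+ d))
           refl _ (f 1) (g (suc k)) ((tail (tail f) *ₛ g) k) _ _ ⟩
    (1 × f 1) * g (suc k) + ((tail (tail f) *ₛ g) k + (∂ (tail f) *ₛ g) k) + (f *ₛ ∂ g) (suc k)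
      ≈⟨ +-congʳ (+-congˡ (*ₛ-distribʳ g (tail (tail f)) (∂ (tail f)) k)) ⟨
    (∂ f *ₛ g) (suc k) + (f *ₛ ∂ g) (suc k) ∎
    where B = (tail f *ₛ g) (suc k)

  *ₛ-low : ∀ f g k → (∀ {i} → i < k → g i ≈ 0#) → (f *ₛ g) k ≈ f 0 * g k
  *ₛ-low f g zero    _   = +-identityʳ _
  *ₛ-low f g (suc k) g≈0 = begin
    f 0 * g (suc k) + (tail f *ₛ g) k
      ≈⟨ +-congˡ (*ₛ-congˡ-≤ (tail f) g 0ₛ k (λ i≤k → g≈0 (s≤s i≤k))) ⟩
    f 0 * g (suc k) + (tail f *ₛ 0ₛ) k
      ≈⟨ +-congˡ (⊛.zeroʳ (tail f) k) ⟩
    f 0 * g (suc k) + 0#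
      ≈⟨ +-identityʳ _ ⟩
    f 0 * g (suc k) ∎

  -- A factor without constant term shifts degrees up by one, so agreement below k suffices in
  -- degree k. This gain drives the induction for the chain rule.
  *ₛ-cong-< : ∀ y g g′ k → y 0 ≈ 0# → (∀ {i} → i < k → g i ≈ g′ i) → (y *ₛ g) k ≈ (y *ₛ g′) k
  *ₛ-cong-< y g g′ zero    y₀ g≈ = +-congʳ (trans (*-congʳ y₀) (trans (zeroˡ _) (sym (trans (*-congʳ y₀) (zeroˡ _)))))
  *ₛ-cong-< y g g′ (suc k) y₀ g≈ =
    +-cong (trans (*-congʳ y₀) (trans (zeroˡ _) (sym (trans (*-congʳ y₀) (zeroˡ _)))))
      (*ₛ-congˡ-≤ (tail y) g g′ k (λ i≤k → g≈ (s≤s i≤k)))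

  ^ₛ-low : ∀ y → y 0 ≈ 0# → ∀ m {i} → i < m → (y ^ₛ m) i ≈ 0#
  ^ₛ-low y y₀ (suc m) {i} (s≤s i≤m) = begin
    (y *ₛ y ^ₛ m) i  ≈⟨ *ₛ-low y (y ^ₛ m) i (λ j<i → ^ₛ-low y y₀ m (ℕ.<-≤-trans j<i i≤m)) ⟩
    y 0 * (y ^ₛ m) i ≈⟨ *-congʳ y₀ ⟩
    0# * (y ^ₛ m) i  ≈⟨ zeroˡ _ ⟩
    0#               ∎

  sum-truncate : ∀ {m n} (f : ℕ → Carrier) → m ≤ n → (∀ {i} → m ≤ i → f i ≈ 0#) →
                 sum {n} (f ∘ toℕ) ≈ sum {m} (f ∘ toℕ)
  sum-truncate {n = n} f z≤n f≈0 =
    trans (sum-cong-≋ {n} {y = λ _ → 0#} (λ i → f≈0 z≤n)) (sum-replicate-zero n)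
  sum-truncate f (s≤s m≤n) f≈0 = +-congˡ (sum-truncate (f ∘ suc) m≤n (f≈0 ∘ s≤s))

  *ₛ-sum : ∀ {n} f (G : Fin n → Series) k → (f *ₛ (λ i → sum λ m → G m i)) k ≈ sum λ m → (f *ₛ G m) k
  *ₛ-sum {zero}  f G k = ⊛.zeroʳ f k
  *ₛ-sum {suc n} f G k =
    trans (*ₛ-distribˡ f (G zero) (λ i → sum λ m → G (suc m) i) k) (+-congˡ (*ₛ-sum f (G ∘ suc) k))

  *ₛ-·ʳ : ∀ f x g → f *ₛ (x · g) ≋ x · (f *ₛ g)
  *ₛ-·ʳ f x g k = trans (*ₛ-comm f (x · g) k) (trans (·-*ₛ x g f k) (*-congˡ (*ₛ-comm g f k)))

  -- The composite Σₘ aₘ yᵐ, for y without constant term.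
  comp : Series → Series → Series
  comp a y k = sum {suc k} λ m → a (toℕ m) * (y ^ₛ toℕ m) k

  comp-+ : ∀ a b y → comp (a +ₛ b) y ≋ comp a y +ₛ comp b y
  comp-+ a b y k = trans (sum-cong-≋ {suc k} λ m → distribʳ ((y ^ₛ toℕ m) k) (a (toℕ m)) (b (toℕ m)))
    (∑-distrib-+ {suc k} (λ m → a (toℕ m) * (y ^ₛ toℕ m) k) (λ m → b (toℕ m) * (y ^ₛ toℕ m) k))

  comp-cong : ∀ {a b} y → a ≋ b → comp a y ≋ comp b y
  comp-cong y a≋b k = sum-cong-≋ {suc k} λ m → *-congʳ {(y ^ₛ toℕ m) k} (a≋b (toℕ m))

  comp-· : ∀ x a y → comp (x · a) y ≋ x · comp a y
  comp-· x a y k = trans (sum-cong-≋ {suc k} λ m → *-assoc x (a (toℕ m)) ((y ^ₛ toℕ m) k))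
    (sym (*-distribˡ-sum {suc k} x (λ m → a (toℕ m) * (y ^ₛ toℕ m) k)))

  -- The number of terms in `comp` varies with the degree. All sums are extended to the common bound
  -- k, which adds only zeros because y^m has no terms below degree m; then product and sum can be
  -- interchanged.
  *ₛ-comp : ∀ f a y → y 0 ≈ 0# → ∀ k → (f *ₛ comp a y) k ≈ sum {suc k} λ m → a (toℕ m) * (f *ₛ y ^ₛ toℕ m) k
  *ₛ-comp f a y y₀ k = begin
    (f *ₛ comp a y) k
      ≈⟨ *ₛ-congˡ-≤ f (comp a y) (λ i → sum {suc k} λ m → a (toℕ m) * (y ^ₛ toℕ m) i) k
           (λ {i} i≤k → sym (sum-truncate (λ m → a m * (y ^ₛ m) i) (s≤s i≤k)
           λ {m} i<m → trans (*-congˡ {a m} (^ₛ-low y y₀ m i<m)) (zeroʳ (a m)))) ⟩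
    (f *ₛ (λ i → sum {suc k} λ m → a (toℕ m) * (y ^ₛ toℕ m) i)) k
      ≈⟨ *ₛ-sum {suc k} f (λ m → a (toℕ m) · y ^ₛ toℕ m) k ⟩
    sum {suc k} (λ m → (f *ₛ (a (toℕ m) · y ^ₛ toℕ m)) k)
      ≈⟨ sum-cong-≋ {suc k} (λ m → *ₛ-·ʳ f (a (toℕ m)) (y ^ₛ toℕ m) k) ⟩
    sum {suc k} (λ m → a (toℕ m) * (f *ₛ y ^ₛ toℕ m) k) ∎

  -- Horner's scheme replaces `a` by `tail a` at the price of a factor `y`, which is what makes
  -- induction on the outer series possible.
  comp-horner : ∀ a y → y 0 ≈ 0# → comp a y ≋ const (a 0) +ₛ y *ₛ comp (tail a) y
  comp-horner a y y₀ zero = begin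
    a 0 * 1# + 0#                            ≈⟨ solve 2 (λ x z → x :* :1 :+ :0 := x :+ (:0 :* z :+ :0)) refl _ _ ⟩
    a 0 + (0# * comp (tail a) y 0 + 0#)      ≈⟨ +-congˡ (+-congʳ (*-congʳ y₀)) ⟨
    a 0 + (y 0 * comp (tail a) y 0 + 0#)     ∎
  comp-horner a y y₀ (suc k) = begin
    a 0 * 0# + sum {suc k} (λ m → a (suc (toℕ m)) * (y *ₛ y ^ₛ toℕ m) (suc k))
      ≈⟨ +-cong (zeroʳ _) (sum-cong-≋ {suc k} λ m → *-congˡ {a (suc (toℕ m))} (shift (y ^ₛ toℕ m))) ⟩
    0# + sum {suc k} (λ m → a (suc (toℕ m)) * (tail y *ₛ y ^ₛ toℕ m) k)
      ≈⟨ +-congˡ (*ₛ-comp (tail y) (tail a) y y₀ k) ⟨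
    0# + (tail y *ₛ comp (tail a) y) k
      ≈⟨ +-congˡ (shift (comp (tail a) y)) ⟨
    0# + (y *ₛ comp (tail a) y) (suc k) ∎
    where
    shift : ∀ g → (y *ₛ g) (suc k) ≈ (tail y *ₛ g) k
    shift g = trans (+-congʳ (trans (*-congʳ y₀) (zeroˡ _))) (+-identityˡ _)


-- Chain rule and binomial series.

module BinomialSeries {c ℓ : Level} (A : ℚ-Algebra c ℓ) where
  open PowerSeries A
  open ℚ-Solver A
  open SeriesRing A
  open Calculus A
  open Algebra.Properties.Semiring.Mult semiring using (×-congʳ; ×-homo-1; ×-comm-*; ×-assoc-*)
  private
    module ⊛ = CommutativeRing seriesRing
    module ⊛S = ℚ-Solver seriesAlgebra
  open ⊛S using () renaming (_:+_ to _⊞_; _:*_ to _⊠_; _:=_ to _≔_; :0 to :0ₛ; :1 to :1ₛ; _:-_ to _⊟_)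

  -- For a = a₀ + x b one has a′ = b + x b′; this is that identity with y substituted for x.
  comp-∂ : ∀ a y → y 0 ≈ 0# → comp (∂ a) y ≋ comp (tail a) y +ₛ y *ₛ comp (∂ (tail a)) y
  comp-∂ a y y₀ = begin
    comp (∂ a) y
      ≈⟨ comp-horner (∂ a) y y₀ ⟩
    const (1 × a 1) +ₛ y *ₛ comp (tail (tail a) +ₛ ∂ (tail a)) y
      ≈⟨ ⊛.+-cong (const-cong (×-homo-1 (a 1))) (⊛.*-congˡ {y} (comp-+ (tail (tail a)) (∂ (tail a)) y)) ⟩
    const (a 1) +ₛ y *ₛ (comp (tail (tail a)) y +ₛ comp (∂ (tail a)) y)
      ≈⟨ ⊛S.solve 4 (λ c y p q → c ⊞ y ⊠ (p ⊞ q) ≔ (c ⊞ y ⊠ p) ⊞ y ⊠ q) ⊛.refl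
            (const (a 1)) y (comp (tail (tail a)) y) (comp (∂ (tail a)) y) ⟩
    const (a 1) +ₛ y *ₛ comp (tail (tail a)) y +ₛ y *ₛ comp (∂ (tail a)) y
      ≈⟨ ⊛.+-congʳ {y *ₛ comp (∂ (tail a)) y} (comp-horner (tail a) y y₀) ⟨
    comp (tail a) y +ₛ y *ₛ comp (∂ (tail a)) y ∎
    where open Relation.Binary.Reasoning.Setoid ⊛.setoid

  -- By Horner both sides differ by y times the same difference for tail a,
  -- so the difference vanishes to every order.
  ∂-comp-< : ∀ n a y → y 0 ≈ 0# → ∀ {k} → k < n → ∂ (comp a y) k ≈ (∂ y *ₛ comp (∂ a) y) k
  ∂-comp-< (suc n) a y y₀ {k} (s≤s k≤n) = begin
    ∂ (comp a y) k
      ≈⟨ ∂-cong (comp-horner a y y₀) k ⟩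
    ∂ (const (a 0) +ₛ y *ₛ comp (tail a) y) k
      ≈⟨ ∂-+ (const (a 0)) (y *ₛ comp (tail a) y) k ⟩
    ∂ (const (a 0)) k + ∂ (y *ₛ comp (tail a) y) k
      ≈⟨ +-cong (∂-const (a 0) k) (∂-* y (comp (tail a) y) k) ⟩
    0# + ((∂ y *ₛ comp (tail a) y) k + (y *ₛ ∂ (comp (tail a) y)) k)
      ≈⟨ +-congˡ (+-congˡ (*ₛ-cong-< y (∂ (comp (tail a) y)) (∂ y *ₛ comp (∂ (tail a)) y) k y₀ λ i<k → ∂-comp-< n (tail a) y y₀ (ℕ.<-≤-trans i<k k≤n))) ⟩
    0# + ((∂ y *ₛ comp (tail a) y) k + (y *ₛ (∂ y *ₛ comp (∂ (tail a)) y)) k)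
      ≈⟨ ⊛S.solve 4 (λ y y′ p q → :0ₛ ⊞ (y′ ⊠ p ⊞ y ⊠ (y′ ⊠ q)) ≔ y′ ⊠ (p ⊞ y ⊠ q)) ⊛.refl
           y (∂ y) (comp (tail a) y) (comp (∂ (tail a)) y) k ⟩
    (∂ y *ₛ (comp (tail a) y +ₛ y *ₛ comp (∂ (tail a)) y)) k
      ≈⟨ ⊛.*-congˡ {∂ y} (comp-∂ a y y₀) k ⟨
    (∂ y *ₛ comp (∂ a) y) k ∎
    where open Relation.Binary.Reasoning.Setoid setoid

  ∂-comp : ∀ a y → y 0 ≈ 0# → ∂ (comp a y) ≋ ∂ y *ₛ comp (∂ a) y
  ∂-comp a y y₀ k = ∂-comp-< (suc k) a y y₀ ℕ.≤-refl

  falling-cong : ∀ {t t′} → t ≈ t′ → ∀ m → falling t m ≈ falling t′ m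
  falling-cong t≈t′ zero    = refl
  falling-cong t≈t′ (suc m) = *-cong (falling-cong t≈t′ m) (+-congʳ t≈t′)

  falling-shift : ∀ t m → falling (t + 1#) (suc m) ≈ (t + 1#) * falling t m
  falling-shift t zero    = solve 1 (λ t → :1 :* (t :+ :1 :- :0) := (t :+ :1) :* :1) refl t
  falling-shift t (suc m) = trans (*-congʳ (falling-shift t m))
    (solve 3 (λ t f m → (t :+ :1) :* f :* (t :+ :1 :- (:1 :+ m)) := (t :+ :1) :* (f :* (t :- m))) refl
      t (falling t m) (m × 1#))

  -- Splits the factor t + 1 as (t - m) + (m + 1).
  falling-pascal : ∀ t m → falling (t + 1#) (suc m) ≈ falling t (suc m) + suc m × falling t m
  falling-pascal t m = begin
    falling (t + 1#) (suc m)
      ≈⟨ falling-shift t m ⟩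
    (t + 1#) * f
      ≈⟨ solve 3 (λ t f m → (t :+ :1) :* f := f :* (t :- m) :+ (:1 :+ m) :* f) refl t f (m × 1#) ⟩
    f * (t - m × 1#) + (suc m × 1#) * f
      ≈⟨ +-congˡ (trans (×-assoc-* (suc m) 1# f) (×-congʳ (suc m) (*-identityˡ f))) ⟩
    f * (t - m × 1#) + suc m × f ∎
    where open Relation.Binary.Reasoning.Setoid setoid
          f = falling t m

  1/suc!-cancel : ∀ m x → 1/ suc m ! * (suc m × x) ≈ 1/ m ! * x
  1/suc!-cancel m x = trans (×-comm-* (suc m) _ x)
    (trans (sym (×-assoc-* (suc m) _ x)) (*-congʳ (suc×1/suc! m)))

  binomial-cong : ∀ {t t′} → t ≈ t′ → binomial t ≋ binomial t′
  binomial-cong t≈t′ m = *-congˡ (falling-cong t≈t′ m)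

  binomial-pascal : ∀ t → tail (binomial (t + 1#)) ≋ tail (binomial t) +ₛ binomial t
  binomial-pascal t m = trans (*-congˡ (falling-pascal t m))
    (trans (distribˡ _ _ _) (+-congˡ (1/suc!-cancel m (falling t m))))

  ∂-binomial : ∀ t → ∂ (binomial (t + 1#)) ≋ (t + 1#) · binomial t
  ∂-binomial t m = begin
    suc m × (1/ suc m ! * falling (t + 1#) (suc m))
      ≈⟨ ×-assoc-* (suc m) _ _ ⟨
    (suc m × 1/ suc m !) * falling (t + 1#) (suc m)
      ≈⟨ *-cong (suc×1/suc! m) (falling-shift t m) ⟩
    1/ m ! * ((t + 1#) * falling t m)
      ≈⟨ solve 3 (λ x y z → x :* (y :* z) := y :* (x :* z)) refl _ _ _ ⟩
    (t + 1#) * (1/ m ! * falling t m) ∎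
    where open Relation.Binary.Reasoning.Setoid setoid

  module _ (h : Series) (h₀ : h 0 ≈ 1#) where
    private
      y : Series
      y = h -ₛ 1ₛ

      y₀ : y 0 ≈ 0#
      y₀ = trans (+-congʳ h₀) (-‿inverseʳ 1#)

    ^^-cong : ∀ {t t′} → t ≈ t′ → h ^^ t ≋ h ^^ t′
    ^^-cong t≈t′ = comp-cong y (binomial-cong t≈t′)

    ^^-const : ∀ t → (h ^^ t) 0 ≈ 1#
    ^^-const t = trans (solve 1 (λ x → x :* :1 :* :1 :+ :0 := x :+ :0) refl (1/ 0 !)) (k!×1/k! 0)

    -- Pascal's rule turns the binomial series for t + 1 into (1 + y)^t + y (1 + y)^t.
    ^^-suc : ∀ t → h ^^ (t + 1#) ≋ h *ₛ h ^^ t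
    ^^-suc t = begin
      h ^^ (t + 1#)
        ≈⟨ comp-horner (binomial (t + 1#)) y y₀ ⟩
      -- The binomial coefficient of index 0 does not depend on the exponent, so the same `c₀`
      -- serves for t + 1 and for t.
      c₀ +ₛ y *ₛ comp (tail (binomial (t + 1#))) y
        ≈⟨ ⊛.+-congˡ {c₀} (⊛.*-congˡ {y} (⊛.trans (comp-cong y (binomial-pascal t)) (comp-+ (tail (binomial t)) (binomial t) y))) ⟩
      c₀ +ₛ y *ₛ (comp (tail (binomial t)) y +ₛ h ^^ t)
        ≈⟨ ⊛S.solve 4 (λ c h p q → c ⊞ (h ⊟ :1ₛ) ⊠ (p ⊞ q) ≔ (c ⊞ (h ⊟ :1ₛ) ⊠ p) ⊞ (h ⊟ :1ₛ) ⊠ q) ⊛.refl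
             c₀ h (comp (tail (binomial t)) y) (h ^^ t) ⟩
      (c₀ +ₛ y *ₛ comp (tail (binomial t)) y) +ₛ y *ₛ h ^^ t
        ≈⟨ ⊛.+-congʳ {y *ₛ h ^^ t} (comp-horner (binomial t) y y₀) ⟨
      h ^^ t +ₛ y *ₛ h ^^ t
        ≈⟨ ⊛S.solve 2 (λ h q → q ⊞ (h ⊟ :1ₛ) ⊠ q ≔ h ⊠ q) ⊛.refl h (h ^^ t) ⟩
      h *ₛ h ^^ t ∎
      where
      open Relation.Binary.Reasoning.Setoid ⊛.setoid
      c₀ = const (binomial t 0)

    ∂-^^ : ∀ t → ∂ (h ^^ (t + 1#)) ≋ (t + 1#) · (∂ h *ₛ h ^^ t)
    ∂-^^ t = begin
      ∂ (h ^^ (t + 1#))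
        ≈⟨ ∂-comp (binomial (t + 1#)) y y₀ ⟩
      ∂ y *ₛ comp (∂ (binomial (t + 1#))) y
        ≈⟨ ⊛.*-cong ∂y (comp-cong y (∂-binomial t)) ⟩
      ∂ h *ₛ comp ((t + 1#) · binomial t) y
        ≈⟨ ⊛.*-congˡ {∂ h} (comp-· (t + 1#) (binomial t) y) ⟩
      ∂ h *ₛ ((t + 1#) · h ^^ t)
        ≈⟨ *ₛ-·ʳ (∂ h) (t + 1#) (h ^^ t) ⟩
      (t + 1#) · (∂ h *ₛ h ^^ t) ∎
      where
      open Relation.Binary.Reasoning.Setoid ⊛.setoid
      ∂y : ∂ y ≋ ∂ h
      ∂y k = ×-congʳ (suc k) (solve 1 (λ x → x :- :0 := x) refl (h (suc k)))

-- The series u, v, q and the powers of u.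

module Trigonometry {c ℓ : Level} (A : ℚ-Algebra c ℓ) where
  open PowerSeries A
  open ℚ-Solver A
  open SeriesRing A
  open Calculus A
  open BinomialSeries A
  open Algebra.Properties.Ring ring using (-0#≈0#; -‿distribʳ-*)
  open Algebra.Properties.Semiring.Mult semiring using (×-homo-1; ×-comm-*; ×-assoc-*)
  private
    module ⊛ = CommutativeRing seriesRing
    module ⊛S = ℚ-Solver seriesAlgebra
  open ⊛S using () renaming (_:+_ to _⊞_; _:*_ to _⊠_; _:=_ to _≔_; :0 to :0ₛ; :1 to :1ₛ; _:-_ to _⊟_; :-_ to ⊟_)

  u v q : Series
  u = cosₛ -ₛ sinₛ
  v = cosₛ +ₛ sinₛ
  q = 1ₛ -ₛ u *ₛ u

  cos⁽suc⁾0 : ∀ k → cos⁽ suc k ⁾0 ≈ - sin⁽ k ⁾0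
  cos⁽suc⁾0 0             = sym -0#≈0#
  cos⁽suc⁾0 1             = refl
  cos⁽suc⁾0 (suc (suc k)) = -‿cong (cos⁽suc⁾0 k)

  sin⁽suc⁾0 : ∀ k → sin⁽ suc k ⁾0 ≈ cos⁽ k ⁾0
  sin⁽suc⁾0 0             = refl
  sin⁽suc⁾0 1             = -0#≈0#
  sin⁽suc⁾0 (suc (suc k)) = -‿cong (sin⁽suc⁾0 k)

  ∂-egf : ∀ k {x y} → x ≈ y → suc k × (1/ suc k ! * x) ≈ 1/ k ! * y
  ∂-egf k {x} x≈y = trans (sym (×-assoc-* (suc k) (1/ suc k !) x)) (*-cong (suc×1/suc! k) x≈y)

  ∂-neg : ∀ f → ∂ (-ₛ f) ≋ -ₛ ∂ f
  ∂-neg f k = n×-neg (suc k)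
    where
    n×-neg : ∀ n {x} → n × (- x) ≈ - (n × x)
    n×-neg zero    = sym -0#≈0#
    n×-neg (suc n) {x} = trans (+-congˡ (n×-neg n))
      (solve 2 (λ a b → :- a :+ :- b := :- (a :+ b)) refl x (n × x))

  ∂-· : ∀ x f → ∂ (x · f) ≋ x · ∂ f
  ∂-· x f k = sym (×-comm-* (suc k) x (f (suc k)))

  ∂-cos : ∂ cosₛ ≋ -ₛ sinₛ
  ∂-cos k = trans (∂-egf k (cos⁽suc⁾0 k)) (sym (-‿distribʳ-* _ _))

  ∂-sin : ∂ sinₛ ≋ cosₛ
  ∂-sin k = ∂-egf k (sin⁽suc⁾0 k)

  ∂-u : ∂ u ≋ -ₛ v
  ∂-u k = trans (∂-+ cosₛ (-ₛ sinₛ) k)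
    (trans (+-cong (∂-cos k) (trans (∂-neg sinₛ k) (-‿cong (∂-sin k))))
      (solve 2 (λ c s → :- s :+ :- c := :- (c :+ s)) refl (cosₛ k) (sinₛ k)))

  ∂-v : ∂ v ≋ u
  ∂-v k = trans (∂-+ cosₛ sinₛ k) (trans (+-cong (∂-cos k) (∂-sin k)) (+-comm _ _))

  1/0!≈1 : 1/ 0 ! ≈ 1#
  1/0!≈1 = trans (sym (×-homo-1 _)) (k!×1/k! 0)

  u-0 : u 0 ≈ 1#
  u-0 = trans (solve 1 (λ x → x :* :1 :- x :* :0 := x) refl (1/ 0 !)) 1/0!≈1

  v-0 : v 0 ≈ 1#
  v-0 = trans (solve 1 (λ x → x :* :1 :+ x :* :0 := x) refl (1/ 0 !)) 1/0!≈1

  u-1 : u 1 ≈ - 1#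
  u-1 = trans (sym (×-homo-1 _)) (trans (∂-u 0) (-‿cong v-0))

  q-0 : q 0 ≈ 0#
  q-0 = trans (+-congˡ (-‿cong (+-congʳ (*-cong u-0 u-0))))
    (solve 0 (:1 :- (:1 :* :1 :+ :0) := :0) refl)

  q-1 : q 1 ≈ 1# + 1#
  q-1 = trans (+-congˡ (-‿cong (+-cong (*-cong u-0 u-1) (+-congʳ (*-cong u-1 u-0)))))
    (solve 0 (:0 :- (:1 :* :- :1 :+ (:- :1 :* :1 :+ :0)) := :1 :+ :1) refl)

  ∂≋0⇒const : ∀ f → ∂ f ≋ 0ₛ → f ≋ const (f 0)
  ∂≋0⇒const f ∂f≋0 zero    = refl
  ∂≋0⇒const f ∂f≋0 (suc k) = ×-torsionfree k (f (suc k)) (∂f≋0 k)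

  -- The derivative vanishes because ∂u = -v and ∂v = u, so only the constant term has to be
  -- computed.
  u²+v²≋2 : u *ₛ u +ₛ v *ₛ v ≋ 1ₛ +ₛ 1ₛ
  u²+v²≋2 = begin
    u *ₛ u +ₛ v *ₛ v
      ≈⟨ ∂≋0⇒const (u *ₛ u +ₛ v *ₛ v) ∂≋0 ⟩
    const ((u 0 * u 0 + 0#) + (v 0 * v 0 + 0#))
      ≈⟨ const-cong (trans (+-cong (+-congʳ (*-cong u-0 u-0)) (+-congʳ (*-cong v-0 v-0)))
           (solve 0 (:1 :* :1 :+ :0 :+ (:1 :* :1 :+ :0) := :1 :+ :1) refl)) ⟩
    const (1# + 1#)
      ≈⟨ const-+ 1# 1# ⟩
    const 1# +ₛ const 1#
      ≈⟨ ⊛.+-cong const-1 const-1 ⟩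
    1ₛ +ₛ 1ₛ ∎
    where
    open Relation.Binary.Reasoning.Setoid ⊛.setoid
    ∂≋0 : ∂ (u *ₛ u +ₛ v *ₛ v) ≋ 0ₛ
    ∂≋0 = begin
      ∂ (u *ₛ u +ₛ v *ₛ v)
        ≈⟨ ∂-+ (u *ₛ u) (v *ₛ v) ⟩
      ∂ (u *ₛ u) +ₛ ∂ (v *ₛ v)
        ≈⟨ ⊛.+-cong (∂-* u u) (∂-* v v) ⟩
      (∂ u *ₛ u +ₛ u *ₛ ∂ u) +ₛ (∂ v *ₛ v +ₛ v *ₛ ∂ v)
        ≈⟨ ⊛.+-cong (⊛.+-cong (⊛.*-congʳ {u} ∂-u) (⊛.*-congˡ {u} ∂-u))
                    (⊛.+-cong (⊛.*-congʳ {v} ∂-v) (⊛.*-congˡ {v} ∂-v)) ⟩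
      ((-ₛ v) *ₛ u +ₛ u *ₛ (-ₛ v)) +ₛ (u *ₛ v +ₛ v *ₛ u)
        ≈⟨ ⊛S.solve 2 (λ u v → ((⊟ v) ⊠ u ⊞ u ⊠ (⊟ v)) ⊞ (u ⊠ v ⊞ v ⊠ u) ≔ :0ₛ) ⊛.refl u v ⟩
      0ₛ ∎

  E : Carrier → Series
  E t = u ^^ t

  E-suc : ∀ t → E (t + 1#) ≋ u *ₛ E t
  E-suc = ^^-suc u u-0

  E-cong : ∀ {t t′} → t ≈ t′ → E t ≋ E t′
  E-cong = ^^-cong u u-0

  ∂-E : ∀ t → ∂ (E (t + 1#)) ≋ (- (t + 1#)) · (v *ₛ E t)
  ∂-E t k = begin
    ∂ (E (t + 1#)) k              ≈⟨ ∂-^^ u u-0 t k ⟩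
    (t + 1#) * (∂ u *ₛ E t) k     ≈⟨ *-congˡ (⊛.*-congʳ {E t} ∂-u k) ⟩
    (t + 1#) * ((-ₛ v) *ₛ E t) k  ≈⟨ *-congˡ (⊛S.solve 2 (λ v e → (⊟ v) ⊠ e ≔ ⊟ (v ⊠ e)) ⊛.refl v (E t) k) ⟩
    (t + 1#) * - (v *ₛ E t) k     ≈⟨ solve 2 (λ t x → t :* :- x := (:- t) :* x) refl (t + 1#) _ ⟩
    - (t + 1#) * (v *ₛ E t) k     ∎
    where open Relation.Binary.Reasoning.Setoid setoid

  -- The square of `v` is traded for 2 - u², and two factors `u` raise the exponent by two, so no
  -- `v` is left. Exponents are counted upwards from r because `E-suc` raises them.
  ∂-vE : ∀ r → ∂ (v *ₛ E (r + 1#)) ≋ (r + 1# + 1#) · E (r + 1# + 1#) +ₛ (- ((1# + 1#) * (r + 1#))) · E r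
  ∂-vE r = begin
    ∂ (v *ₛ E t)
      ≈⟨ ∂-* v (E t) ⟩
    ∂ v *ₛ E t +ₛ v *ₛ ∂ (E t)
      ≈⟨ ⊛.+-cong (⊛.*-congʳ {E t} ∂-v) (⊛.*-congˡ {v} (∂-E r)) ⟩
    u *ₛ E t +ₛ v *ₛ ((- t) · (v *ₛ E r))
      ≈⟨ ⊛.+-cong (⊛.*-congˡ {u} (E-suc r)) (⊛.*-congˡ {v} (⊛.sym (const-*ₛ (- t) (v *ₛ E r)))) ⟩
    u *ₛ (u *ₛ e) +ₛ v *ₛ (const (- t) *ₛ (v *ₛ e))
      ≈⟨ ⊛S.solve 4 (λ u v e t → u ⊠ (u ⊠ e) ⊞ v ⊠ (t ⊠ (v ⊠ e))
             ≔ u ⊠ (u ⊠ e) ⊟ t ⊠ (u ⊠ (u ⊠ e)) ⊞ t ⊠ ((u ⊠ u ⊞ v ⊠ v) ⊠ e)) ⊛.refl u v e (const (- t)) ⟩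
    u *ₛ (u *ₛ e) -ₛ const (- t) *ₛ (u *ₛ (u *ₛ e)) +ₛ const (- t) *ₛ ((u *ₛ u +ₛ v *ₛ v) *ₛ e)
      ≈⟨ ⊛.+-cong (⊛.+-cong E-suc² (⊛.-‿cong (⊛.trans (const-*ₛ (- t) _) (λ k → *-congˡ (E-suc² k)))))
                  (⊛.trans (const-*ₛ (- t) _) (λ k → *-congˡ (⊛.*-congʳ {e} u²+v²≋2 k))) ⟩
    E (t + 1#) -ₛ (- t) · E (t + 1#) +ₛ (- t) · ((1ₛ +ₛ 1ₛ) *ₛ e)
      ≈⟨ ⊛.+-congˡ {E (t + 1#) -ₛ (- t) · E (t + 1#)} (λ k → *-congˡ (⊛S.solve 1 (λ e → (:1ₛ ⊞ :1ₛ) ⊠ e ≔ e ⊞ e) ⊛.refl e k)) ⟩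
    E (t + 1#) -ₛ (- t) · E (t + 1#) +ₛ (- t) · (e +ₛ e)
      ≈⟨ (λ k → solve 3 (λ t x y → x :- (:- t) :* x :+ (:- t) :* (y :+ y) := (t :+ :1) :* x :+ (:- ((:1 :+ :1) :* t)) :* y)
           refl t (E (t + 1#) k) (e k)) ⟩
    (t + 1#) · E (t + 1#) +ₛ (- ((1# + 1#) * t)) · e ∎
    where
    open Relation.Binary.Reasoning.Setoid ⊛.setoid
    t = r + 1#
    e = E r
    E-suc² : u *ₛ (u *ₛ e) ≋ E (t + 1#)
    E-suc² = ⊛.sym (⊛.trans (E-suc t) (⊛.*-congˡ {u} (E-suc r)))

  -- Each power of `u` in `∂-vE` regains a factor `v` from ∂u = -v. The exponent r, two below t, is
  -- that of the next member of the family F_k.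
  ∂²-vE : ∀ r → let t = r + 1# + 1# in
          ∂ (∂ (v *ₛ E t)) ≋ (- ((t + 1#) * (t + 1#))) · (v *ₛ E t) +ₛ ((1# + 1#) * (t * (r + 1#))) · (v *ₛ E r)
  ∂²-vE r k = begin
    ∂ (∂ (v *ₛ E t)) k
      ≈⟨ ∂-cong (∂-vE (r + 1#)) k ⟩
    ∂ ((t + 1#) · E (t + 1#) +ₛ (- ((1# + 1#) * t)) · E (r + 1#)) k
      ≈⟨ ∂-+ ((t + 1#) · E (t + 1#)) ((- ((1# + 1#) * t)) · E (r + 1#)) k ⟩
    ∂ ((t + 1#) · E (t + 1#)) k + ∂ ((- ((1# + 1#) * t)) · E (r + 1#)) k
      ≈⟨ +-cong (∂-· (t + 1#) (E (t + 1#)) k) (∂-· (- ((1# + 1#) * t)) (E (r + 1#)) k) ⟩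
    (t + 1#) * ∂ (E (t + 1#)) k + - ((1# + 1#) * t) * ∂ (E (r + 1#)) k
      ≈⟨ +-cong (*-congˡ (∂-E t k)) (*-congˡ (∂-E r k)) ⟩
    (t + 1#) * (- (t + 1#) * (v *ₛ E t) k) + - ((1# + 1#) * t) * (- (r + 1#) * (v *ₛ E r) k)
      ≈⟨ solve 4 (λ t r x y → (t :+ :1) :* ((:- (t :+ :1)) :* x) :+ (:- ((:1 :+ :1) :* t)) :* ((:- (r :+ :1)) :* y)
            := (:- ((t :+ :1) :* (t :+ :1))) :* x :+ ((:1 :+ :1) :* (t :* (r :+ :1))) :* y)
           refl t r ((v *ₛ E t) k) ((v *ₛ E r) k) ⟩
    - ((t + 1#) * (t + 1#)) * (v *ₛ E t) k + (1# + 1#) * (t * (r + 1#)) * (v *ₛ E r) k ∎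
    where
    open Relation.Binary.Reasoning.Setoid setoid
    t = r + 1# + 1#

  ^ₛ-lead : ∀ y → y 0 ≈ 0# → ∀ m → (y ^ₛ m) m ≈ y 1 ^ m
  ^ₛ-lead y y₀ zero    = refl
  ^ₛ-lead y y₀ (suc m) = begin
    y 0 * (y ^ₛ m) (suc m) + (tail y *ₛ y ^ₛ m) m
      ≈⟨ +-cong (trans (*-congʳ y₀) (zeroˡ _)) (*ₛ-low (tail y) (y ^ₛ m) m (^ₛ-low y y₀ m)) ⟩
    0# + y 1 * (y ^ₛ m) m
      ≈⟨ trans (+-identityˡ _) (*-congˡ (^ₛ-lead y y₀ m)) ⟩
    y 1 * y 1 ^ m ∎
    where open Relation.Binary.Reasoning.Setoid setoid

  G : Carrier → ℕ → Series
  G t m = q ^ₛ m *ₛ (v *ₛ E t)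

  -- `v *ₛ E t` has constant term 1 and q^m starts in degree m, so up to that degree the factor, and
  -- with it the exponent t, is invisible.
  G-coeff : ∀ t m {j} → j ≤ m → G t m j ≈ (q ^ₛ m) j
  G-coeff t m {j} j≤m = begin
    (q ^ₛ m *ₛ (v *ₛ E t)) j        ≈⟨ *ₛ-comm (q ^ₛ m) (v *ₛ E t) j ⟩
    ((v *ₛ E t) *ₛ q ^ₛ m) j        ≈⟨ *ₛ-low (v *ₛ E t) (q ^ₛ m) j (λ i<j → ^ₛ-low q q-0 m (ℕ.<-≤-trans i<j j≤m)) ⟩
    (v 0 * E t 0 + 0#) * (q ^ₛ m) j ≈⟨ *-congʳ (+-congʳ (*-cong v-0 (^^-const u u-0 t))) ⟩
    (1# * 1# + 0#) * (q ^ₛ m) j     ≈⟨ solve 1 (λ x → (:1 :* :1 :+ :0) :* x := x) refl _ ⟩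
    (q ^ₛ m) j                      ∎
    where open Relation.Binary.Reasoning.Setoid setoid

  G-low : ∀ t m {j} → j < m → G t m j ≈ 0#
  G-low t m j<m = trans (G-coeff t m (ℕ.<⇒≤ j<m)) (^ₛ-low q q-0 m j<m)

  G-lead : ∀ t m → G t m m ≈ (1# + 1#) ^ m
  G-lead t m = trans (G-coeff t m ℕ.≤-refl) (trans (^ₛ-lead q q-0 m) (^-congˡ m q-1))
    where open Algebra.Properties.Semiring.Exp semiring using (^-congˡ)

  -- Multiply by 1 = u² + q: the summand u² raises the exponent by two, the summand q raises m.
  G-split : ∀ r m → G r m ≋ G (r + 1# + 1#) m +ₛ G r (suc m)
  G-split r m = begin
    q ^ₛ m *ₛ (v *ₛ E r)
      ≈⟨ ⊛S.solve 4 (λ p v u e → p ⊠ (v ⊠ e) ≔ p ⊠ (v ⊠ (u ⊠ (u ⊠ e))) ⊞ ((:1ₛ ⊟ u ⊠ u) ⊠ p) ⊠ (v ⊠ e))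
           ⊛.refl (q ^ₛ m) v u (E r) ⟩
    q ^ₛ m *ₛ (v *ₛ (u *ₛ (u *ₛ E r))) +ₛ G r (suc m)
      ≈⟨ ⊛.+-congʳ {G r (suc m)} (⊛.*-congˡ {q ^ₛ m} (⊛.*-congˡ {v}
           (⊛.trans (E-suc (r + 1#)) (⊛.*-congˡ {u} (E-suc r))))) ⟨
    G (r + 1# + 1#) m +ₛ G r (suc m) ∎
    where open Relation.Binary.Reasoning.Setoid ⊛.setoid

-- Determinants as alternating forms on lists of columns.

module Determinant {c ℓ : Level} (A : ℚ-Algebra c ℓ) where
  open PowerSeries A
  open ℚ-Solver A
  open SeriesRing A using (_≋_; _·_)
  open Algebra.Properties.Semiring.Sum semiring using (sum-cong-≋; *-distribˡ-sum; sum-replicate-zero)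
  private module Π = Algebra.Properties.CommutativeMonoid.Sum *-commutativeMonoid
  open Relation.Binary.Reasoning.Setoid setoid

  -- Columns are infinite and keep the absolute row index, so passing to a minor advances the first
  -- row and leaves the columns unchanged.
  Column : Set c
  Column = ℕ → Carrier

  Form : Set c
  Form = List Column → Carrier

  -- Vanishing on adjacent equal columns is what expansion along a row visibly preserves, and it
  -- suffices for interchanging neighbours. The prefix `us` lets the property pass to `φ ∘ (v ∷_)`,
  -- the form met in the recursion of `expand`.
  record IsAlternating (φ : Form) : Set (c ⊔ ℓ) where
    field
      cong        : ∀ {vs ws} → Pointwise _≋_ vs ws → φ vs ≈ φ ws
      linear      : ∀ us a v b w vs →
                    φ (us ++ (a · v +ₛ b · w) ∷ vs) ≈ a * φ (us ++ v ∷ vs) + b * φ (us ++ w ∷ vs)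
      alternating : ∀ us v vs → φ (us ++ v ∷ v ∷ vs) ≈ 0#

  open IsAlternating

  -- Laplace expansion along row r, where φ evaluates the minors.
  expand : ℕ → Form → Form
  expand r φ []       = 0#
  expand r φ (v ∷ vs) = v r * φ vs - expand r (φ ∘ (v ∷_)) vs

  -- The determinant of the rows r, …, r + n - 1 of n columns.
  minor : ℕ → ℕ → Form
  minor zero    r []      = 1#
  minor zero    r (_ ∷ _) = 0#
  minor (suc n) r         = expand r (minor n (suc r))

  Pointwise-refl : ∀ {vs : List Column} → Pointwise _≋_ vs vs
  Pointwise-refl = Pointwise.refl (λ _ → refl)

  ∷-isAlternating : ∀ {φ} v → IsAlternating φ → IsAlternating (φ ∘ (v ∷_))
  ∷-isAlternating v alt = record
    { cong        = λ ps → cong alt ((λ _ → refl) ∷ ps)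
    ; linear      = λ us → linear alt (v ∷ us)
    ; alternating = λ us → alternating alt (v ∷ us)
    }

  expand-linear : ∀ r {φ ψ χ} a b → (∀ vs → φ vs ≈ a * ψ vs + b * χ vs) →
                  ∀ vs → expand r φ vs ≈ a * expand r ψ vs + b * expand r χ vs
  expand-linear r a b φ≈ []       = solve 2 (λ a b → :0 := a :* :0 :+ b :* :0) refl a b
  expand-linear r a b φ≈ (v ∷ vs) =
    trans (+-cong (*-congˡ (φ≈ vs)) (-‿cong (expand-linear r a b (λ ws → φ≈ (v ∷ ws)) vs)))
      (solve 7 (λ x a b p q s t → x :* (a :* p :+ b :* q) :- (a :* s :+ b :* t)
          := a :* (x :* p :- s) :+ b :* (x :* q :- t)) refl (v r) a b _ _ _ _)

  expand-cong : ∀ r {φ ψ} → (∀ vs → φ vs ≈ ψ vs) → ∀ vs → expand r φ vs ≈ expand r ψ vs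
  expand-cong r φ≈ []       = refl
  expand-cong r φ≈ (v ∷ vs) = +-cong (*-congˡ (φ≈ vs)) (-‿cong (expand-cong r (λ ws → φ≈ (v ∷ ws)) vs))

  expand-zero : ∀ r {φ} → (∀ vs → φ vs ≈ 0#) → ∀ vs → expand r φ vs ≈ 0#
  expand-zero r φ≈ []       = refl
  expand-zero r φ≈ (v ∷ vs) = trans (+-cong (*-congˡ (φ≈ vs)) (-‿cong (expand-zero r (λ ws → φ≈ (v ∷ ws)) vs)))
    (solve 1 (λ x → x :* :0 :- :0 := :0) refl (v r))

  expand-low : ∀ r φ {vs} → All (λ v → v r ≈ 0#) vs → expand r φ vs ≈ 0#
  expand-low r φ []                     = refl
  expand-low r φ (_∷_ {v} {vs} v≈0 vs≈0) =
    trans (+-cong (*-congʳ v≈0) (-‿cong (expand-low r (φ ∘ (v ∷_)) vs≈0)))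
      (solve 1 (λ x → :0 :* x :- :0 := :0) refl (φ vs))

  expand-isAlternating : ∀ r {φ} → IsAlternating φ → IsAlternating (expand r φ)
  expand-isAlternating r alt = record
    { cong = expand-≋ alt ; linear = expand-multilinear alt ; alternating = expand-alternating alt }
    where
    expand-≋ : ∀ {φ} → IsAlternating φ → ∀ {vs ws} → Pointwise _≋_ vs ws → expand r φ vs ≈ expand r φ ws
    expand-≋ alt []                                    = refl
    expand-≋ alt (_∷_ {x = v} {ys = ws} p ps) = +-cong (*-cong (p r) (cong alt ps))
      (-‿cong (trans (expand-≋ (∷-isAlternating v alt) ps)
        (expand-cong r (λ us → cong alt (p ∷ Pointwise-refl)) ws)))

    expand-multilinear : ∀ {φ} → IsAlternating φ → ∀ us a v b w vs →
      expand r φ (us ++ (a · v +ₛ b · w) ∷ vs) ≈ a * expand r φ (us ++ v ∷ vs) + b * expand r φ (us ++ w ∷ vs)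
    expand-multilinear {φ} alt [] a v b w vs =
      trans (+-congˡ (-‿cong (expand-linear r a b (λ us → linear alt [] a v b w us) vs)))
        (solve 7 (λ a x b y p s t → (a :* x :+ b :* y) :* p :- (a :* s :+ b :* t)
          := a :* (x :* p :- s) :+ b :* (y :* p :- t)) refl a (v r) b (w r) (φ vs) _ _)
    expand-multilinear alt (u ∷ us) a v b w vs =
      trans (+-cong (*-congˡ (linear alt us a v b w vs))
          (-‿cong (expand-multilinear (∷-isAlternating u alt) us a v b w vs)))
        (solve 7 (λ x a b p q s t → x :* (a :* p :+ b :* q) :- (a :* s :+ b :* t)
          := a :* (x :* p :- s) :+ b :* (x :* q :- t)) refl (u r) a b _ _ _ _)

    expand-alternating : ∀ {φ} → IsAlternating φ → ∀ us v vs → expand r φ (us ++ v ∷ v ∷ vs) ≈ 0#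
    expand-alternating {φ} alt [] v vs =
      -- The two leading terms are equal with opposite signs; every later minor still contains both
      -- copies of `v`.
      trans (+-congˡ (-‿cong (+-congˡ (-‿cong (expand-zero r (alternating alt [] v) vs)))))
        (solve 1 (λ x → x :- (x :- :0) := :0) refl (v r * φ (v ∷ vs)))
    expand-alternating alt (u ∷ us) v vs =
      trans (+-cong (*-congˡ (alternating alt us v vs)) (-‿cong (expand-alternating (∷-isAlternating u alt) us v vs)))
        (solve 1 (λ x → x :* :0 :- :0 := :0) refl (u r))

  minor-isAlternating : ∀ n r → IsAlternating (minor n r)
  minor-isAlternating zero r = record
    { cong        = λ { [] → refl ; (_ ∷ _) → refl }
    ; linear      = λ { [] a _ b _ _ → 0≈ a b ; (_ ∷ _) a _ b _ _ → 0≈ a b }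
    ; alternating = λ { [] _ _ → refl ; (_ ∷ _) _ _ → refl }
    }
    where
    0≈ : ∀ a b → 0# ≈ a * 0# + b * 0#
    0≈ = solve 2 (λ a b → :0 := a :* :0 :+ b :* :0) refl
  minor-isAlternating (suc n) r = expand-isAlternating r (minor-isAlternating n (suc r))

  module _ {φ : Form} (alt : IsAlternating φ) where

    scale : ∀ a v vs → φ (a · v ∷ vs) ≈ a * φ (v ∷ vs)
    scale a v vs = begin
      φ (a · v ∷ vs)
        ≈⟨ cong alt ((λ k → solve 2 (λ a x → a :* x := a :* x :+ :0 :* x) refl a (v k)) ∷ Pointwise-refl) ⟩
      φ ((a · v +ₛ 0# · v) ∷ vs)
        ≈⟨ linear alt [] a v 0# v vs ⟩
      a * φ (v ∷ vs) + 0# * φ (v ∷ vs)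
        ≈⟨ solve 2 (λ a x → a :* x :+ :0 :* x := a :* x) refl a _ ⟩
      a * φ (v ∷ vs) ∎

    -- Polarisation: the form vanishes with v + w in both leading places, and with v, v and w, w
    -- there, which leaves the two mixed terms.
    swap : ∀ v w vs → φ (v ∷ w ∷ vs) ≈ - φ (w ∷ v ∷ vs)
    swap v w vs = begin
      φ (v ∷ w ∷ vs)
        ≈⟨ solve 4 (λ a b p q → a := (:1 :* (:1 :* p :+ :1 :* a) :+ :1 :* (:1 :* b :+ :1 :* q)) :- p :- q :- b) refl
             (φ (v ∷ w ∷ vs)) (φ (w ∷ v ∷ vs)) (φ (v ∷ v ∷ vs)) (φ (w ∷ w ∷ vs)) ⟩
      (1# * (1# * φ (v ∷ v ∷ vs) + 1# * φ (v ∷ w ∷ vs)) + 1# * (1# * φ (w ∷ v ∷ vs) + 1# * φ (w ∷ w ∷ vs)))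
        - φ (v ∷ v ∷ vs) - φ (w ∷ w ∷ vs) - φ (w ∷ v ∷ vs)
        ≈⟨ +-congʳ (+-cong (+-cong expansion (-‿cong (alternating alt [] v vs))) (-‿cong (alternating alt [] w vs))) ⟩
      0# - 0# - 0# - φ (w ∷ v ∷ vs)
        ≈⟨ solve 1 (λ x → :0 :- :0 :- :0 :- x := :- x) refl _ ⟩
      - φ (w ∷ v ∷ vs) ∎
      where
      v+w = 1# · v +ₛ 1# · w
      expansion : 1# * (1# * φ (v ∷ v ∷ vs) + 1# * φ (v ∷ w ∷ vs))
                  + 1# * (1# * φ (w ∷ v ∷ vs) + 1# * φ (w ∷ w ∷ vs)) ≈ 0#
      expansion = begin
        _ ≈⟨ +-cong (*-congˡ (linear alt (v ∷ []) 1# v 1# w vs)) (*-congˡ (linear alt (w ∷ []) 1# v 1# w vs)) ⟨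
        1# * φ (v ∷ v+w ∷ vs) + 1# * φ (w ∷ v+w ∷ vs) ≈⟨ linear alt [] 1# v 1# w (v+w ∷ vs) ⟨
        φ (v+w ∷ v+w ∷ vs) ≈⟨ alternating alt [] v+w vs ⟩
        0# ∎

  -- Once the column next to `v` is cleared, the two change places, and the cleared column joins the
  -- form as a fixed first argument. So `v` travels along the list; the signs of the swaps there and
  -- back cancel.
  eliminate : ∀ {φ} → IsAlternating φ → ∀ v {ws zs} →
              Pointwise (λ w z → ∃ λ b → w ≋ z +ₛ b · v) ws zs → φ (v ∷ ws) ≈ φ (v ∷ zs)
  eliminate alt v [] = refl
  eliminate {φ} alt v (_∷_ {w} {z} {ws} {zs} (b , w≋) ps) = begin
    φ (v ∷ w ∷ ws)
      ≈⟨ cong alt ((λ _ → refl) ∷ (λ k → trans (w≋ k) (+-congʳ (sym (*-identityˡ (z k))))) ∷ Pointwise-refl) ⟩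
    φ (v ∷ (1# · z +ₛ b · v) ∷ ws)
      ≈⟨ linear alt (v ∷ []) 1# z b v ws ⟩
    1# * φ (v ∷ z ∷ ws) + b * φ (v ∷ v ∷ ws)
      ≈⟨ +-congˡ (*-congˡ (alternating alt [] v ws)) ⟩
    1# * φ (v ∷ z ∷ ws) + b * 0#
      ≈⟨ solve 2 (λ b x → :1 :* x :+ b :* :0 := x) refl b _ ⟩
    φ (v ∷ z ∷ ws)
      ≈⟨ swap alt v z ws ⟩
    - φ (z ∷ v ∷ ws)
      ≈⟨ -‿cong (eliminate (∷-isAlternating z alt) v ps) ⟩
    - φ (z ∷ v ∷ zs)
      ≈⟨ swap alt v z zs ⟨
    φ (v ∷ z ∷ zs) ∎

  -- The signs of the Laplace sum become the nested subtractions of `expand`: every minor after the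
  -- first keeps column 0 in front, so that column moves into the form.
  expand-tabulate : ∀ {n} r φ (f : Fin (suc n) → Column) →
    sum (λ j → (- 1#) ^ toℕ j * (f j r * φ (tabulate (f ∘ punchIn j)))) ≈ expand r φ (tabulate f)
  expand-tabulate {zero} r φ f =
    solve 2 (λ x y → :1 :* (x :* y) :+ :0 := x :* y :- :0) refl (f zero r) (φ [])
  expand-tabulate {suc n} r φ f = +-cong (*-identityˡ _) (begin
    sum (λ j → (- 1# * (- 1#) ^ toℕ j) * t j)
      ≈⟨ sum-cong-≋ {suc n} (λ j → *-assoc (- 1#) ((- 1#) ^ toℕ j) (t j)) ⟩
    sum (λ j → - 1# * ((- 1#) ^ toℕ j * t j))
      ≈⟨ *-distribˡ-sum {suc n} (- 1#) (λ j → (- 1#) ^ toℕ j * t j) ⟨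
    - 1# * sum (λ j → (- 1#) ^ toℕ j * t j)
      ≈⟨ Algebra.Properties.Ring.-1*x≈-x ring _ ⟩
    - sum (λ j → (- 1#) ^ toℕ j * t j)
      ≈⟨ -‿cong (expand-tabulate r (φ ∘ (f zero ∷_)) (f ∘ suc)) ⟩
    - expand r (φ ∘ (f zero ∷_)) (tabulate (f ∘ suc)) ∎)
    where
    t : Fin (suc n) → Carrier
    t j = f (suc j) r * φ (f zero ∷ tabulate (f ∘ suc ∘ punchIn j))

  det-minor : ∀ {n} r (M : Matrix n) (f : Fin n → Column) →
              (∀ i j → M i j ≈ f j (r ℕ.+ toℕ i)) → det M ≈ minor n r (tabulate f)
  det-minor {zero}  r M f M≈ = refl
  det-minor {suc n} r M f M≈ = trans
    (sum-cong-≋ {suc n} λ j → *-congˡ {(- 1#) ^ toℕ j} (*-cong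
      (trans (M≈ zero j) (reflexive (≡.cong (f j) (ℕ.+-identityʳ r))))
      (det-minor (suc r) (λ i k → M (suc i) (punchIn j k)) (f ∘ punchIn j)
        (λ i k → trans (M≈ (suc i) (punchIn j k)) (reflexive (≡.cong (f (punchIn j k)) (ℕ.+-suc r (toℕ i))))))))
    (expand-tabulate r (minor n (suc r)) f)

  -- Triangularity of `Q` makes column 0 a multiple of `P zero`. Its multiples are removed from the
  -- other columns, which then vanish in row r, so a single minor survives; it has the same shape
  -- with first row r + 1.
  minor-LU : ∀ {n} r (f : Fin n → Column) (P : Fin n → Column) (Q : Fin n → Fin n → Carrier) →
             (∀ j i → f j i ≈ sum λ m → Q m j * P m i) →
             (∀ m {i} → i < r ℕ.+ toℕ m → P m i ≈ 0#) →
             (∀ m j → toℕ j < toℕ m → Q m j ≈ 0#) →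
             minor n r (tabulate f) ≈ product λ m → Q m m * P m (r ℕ.+ toℕ m)
  minor-LU {zero}  r f P Q f≈ P≈0 Q≈0 = refl
  minor-LU {suc n} r f P Q f≈ P≈0 Q≈0 = begin
    φ (f zero ∷ tabulate (f ∘ suc))
      ≈⟨ cong alt (f₀≋ ∷ Pointwise-refl) ⟩
    φ (Q zero zero · P zero ∷ tabulate (f ∘ suc))
      ≈⟨ scale alt (Q zero zero) (P zero) (tabulate (f ∘ suc)) ⟩
    Q zero zero * φ (P zero ∷ tabulate (f ∘ suc))
      ≈⟨ *-congˡ (eliminate alt (P zero) (Pointwise.tabulate⁺ λ j →
           Q zero (suc j) , λ i → trans (f≈ (suc j) i) (+-comm _ _))) ⟩
    Q zero zero * (P zero r * minor n (suc r) (tabulate g) - expand r (minor n (suc r) ∘ (P zero ∷_)) (tabulate g))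
      ≈⟨ *-congˡ (+-cong
           (*-cong (reflexive (≡.cong (P zero) (≡.sym (ℕ.+-identityʳ r)))) (minor-LU (suc r) g (P ∘ suc) (λ m j → Q (suc m) (suc j))
             (λ j i → refl) (λ m {i} i< → P≈0 (suc m) (≡.subst (i <_) (≡.sym (ℕ.+-suc r (toℕ m))) i<))
             (λ m j j<m → Q≈0 (suc m) (suc j) (s≤s j<m))))
           (-‿cong (expand-low r _ (All.tabulate⁺ g-low)))) ⟩
    Q zero zero * (P zero (r ℕ.+ 0) * product (λ m → Q (suc m) (suc m) * P (suc m) (suc r ℕ.+ toℕ m)) - 0#)
      ≈⟨ solve 3 (λ x y z → x :* (y :* z :- :0) := x :* y :* z) refl _ _ _ ⟩
    Q zero zero * P zero (r ℕ.+ 0) * product (λ m → Q (suc m) (suc m) * P (suc m) (suc r ℕ.+ toℕ m))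
      ≈⟨ *-congˡ (Π.sum-cong-≋ {n} λ m → *-congˡ {Q (suc m) (suc m)} (reflexive (≡.cong (P (suc m)) (≡.sym (ℕ.+-suc r (toℕ m)))))) ⟩
    Q zero zero * P zero (r ℕ.+ 0) * product (λ m → Q (suc m) (suc m) * P (suc m) (r ℕ.+ suc (toℕ m))) ∎
    where
    φ = minor (suc n) r
    alt = minor-isAlternating (suc n) r
    g : Fin n → Column
    g j i = sum λ m → Q (suc m) (suc j) * P (suc m) i
    f₀≋ : f zero ≋ Q zero zero · P zero
    f₀≋ i = begin
      f zero i
        ≈⟨ f≈ zero i ⟩
      Q zero zero * P zero i + sum (λ m → Q (suc m) zero * P (suc m) i)
        ≈⟨ +-congˡ (trans (sum-cong-≋ {n} {y = λ _ → 0#} λ m → trans (*-congʳ (Q≈0 (suc m) zero (s≤s z≤n))) (zeroˡ _)) (sum-replicate-zero n)) ⟩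
      Q zero zero * P zero i + 0#
        ≈⟨ +-identityʳ _ ⟩
      Q zero zero * P zero i ∎
    g-low : ∀ j → g j r ≈ 0#
    g-low j = trans (sum-cong-≋ {n} {y = λ _ → 0#} λ m →
        trans (*-congˡ (P≈0 (suc m) (ℕ.m<m+n r (s≤s z≤n)))) (zeroʳ _))
      (sum-replicate-zero n)

-- Newton interpolation and iterated recurrences.

module Recurrences {c ℓ : Level} (A : ℚ-Algebra c ℓ) where
  open PowerSeries A
  open ℚ-Solver A
  open Algebra.Properties.Semiring.Sum semiring
    using (sum-cong-≋; *-distribˡ-sum; ∑-distrib-+; sum-replicate-zero)
  private module Π = Algebra.Properties.CommutativeMonoid.Sum *-commutativeMonoid
  open Relation.Binary.Reasoning.Setoid setoid

  -- Binomial coefficients with Pascal's rule as defining equation, so that the induction in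
  -- `newton` uses it by computation.
  choose : ℕ → ℕ → Carrier
  choose _       zero    = 1#
  choose zero    (suc _) = 0#
  choose (suc k) (suc m) = choose k m + choose k (suc m)

  choose-low : ∀ {k m} → k < m → choose k m ≈ 0#
  choose-low {zero}  (s≤s _)   = refl
  choose-low {suc k} (s≤s k<m) =
    trans (+-cong (choose-low k<m) (choose-low (ℕ.m≤n⇒m≤1+n k<m))) (+-identityˡ 0#)

  choose-diag : ∀ m → choose m m ≈ 1#
  choose-diag zero    = refl
  choose-diag (suc m) = trans (+-cong (choose-diag m) (choose-low {m} {suc m} ℕ.≤-refl)) (+-identityʳ 1#)

  -- Newton's forward difference formula: h p is the p-th difference of h 0.
  newton : ∀ (h : ℕ → ℕ → Carrier) {n} → (∀ p k → h p (suc k) ≈ h p k + h (suc p) k) →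
           (∀ p k → n ≤ p → h p k ≈ 0#) →
           ∀ N p → n ≤ N ℕ.+ p → ∀ k → h p k ≈ sum {N} λ m → choose k (toℕ m) * h (toℕ m ℕ.+ p) 0
  newton h step h≈0 zero    p n≤ k       = h≈0 p k n≤
  newton h step h≈0 (suc N) p n≤ zero    = begin
    h p 0
      ≈⟨ solve 1 (λ x → x := :1 :* x :+ :0) refl (h p 0) ⟩
    1# * h p 0 + 0#
      ≈⟨ +-congˡ (trans (sum-cong-≋ {N} {y = λ _ → 0#} λ m → zeroˡ (h (suc (toℕ m ℕ.+ p)) 0)) (sum-replicate-zero N)) ⟨
    1# * h p 0 + sum {N} (λ m → 0# * h (suc (toℕ m ℕ.+ p)) 0) ∎
  newton h {n} step h≈0 (suc N) p n≤ (suc k) = begin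
    h p (suc k)
      ≈⟨ step p k ⟩
    h p k + h (suc p) k
      -- A difference of order one higher needs one term fewer: N + p stays fixed, and at N = 0 the
      -- order is at least n.
      ≈⟨ +-cong (newton h step h≈0 (suc N) p n≤ k) (newton h step h≈0 N (suc p) (≡.subst (n ≤_) (≡.sym (ℕ.+-suc N p)) n≤) k) ⟩
    1# * h p 0 + sum {N} b + sum {N} (λ m → choose k (toℕ m) * h (toℕ m ℕ.+ suc p) 0)
      ≈⟨ +-congˡ (sum-cong-≋ {N} λ m → *-congˡ {choose k (toℕ m)} (reflexive (≡.cong (λ i → h i 0) (ℕ.+-suc (toℕ m) p)))) ⟩
    1# * h p 0 + sum {N} b + sum {N} a
      ≈⟨ solve 3 (λ x y z → x :+ y :+ z := x :+ (z :+ y)) refl _ (sum {N} b) (sum {N} a) ⟩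
    1# * h p 0 + (sum {N} a + sum {N} b)
      ≈⟨ +-congˡ (∑-distrib-+ {N} a b) ⟨
    1# * h p 0 + sum {N} (λ m → a m + b m)
      ≈⟨ +-congˡ (sum-cong-≋ {N} λ m → distribʳ (h (suc (toℕ m ℕ.+ p)) 0) (choose k (toℕ m)) (choose k (suc (toℕ m)))) ⟨
    1# * h p 0 + sum {N} (λ m → (choose k (toℕ m) + choose k (suc (toℕ m))) * h (suc (toℕ m ℕ.+ p)) 0) ∎
    where
    a b : Fin N → Carrier
    a m = choose k (toℕ m) * h (suc (toℕ m ℕ.+ p)) 0
    b m = choose k (suc (toℕ m)) * h (suc (toℕ m ℕ.+ p)) 0

  -- If D² acts on a family of series by D² Fₖ = αₖ Fₖ + βₖ Fₖ₊₁ and g k = λ(Fₖ) for a linear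
  -- functional λ, then iterate g i k = λ(D²ⁱ Fₖ).
  module Iterate (α β : ℕ → Carrier) where

    iterate : (ℕ → Carrier) → ℕ → ℕ → Carrier
    iterate g zero    k = g k
    iterate g (suc i) k = α k * iterate g i k + β k * iterate g i (suc k)

    iterate-cong : ∀ {g g′} → (∀ k → g k ≈ g′ k) → ∀ i k → iterate g i k ≈ iterate g′ i k
    iterate-cong g≈ zero    k = g≈ k
    iterate-cong g≈ (suc i) k = +-cong (*-congˡ (iterate-cong g≈ i k)) (*-congˡ (iterate-cong g≈ i (suc k)))

    iterate-sum : ∀ {n} (x : Fin n → Carrier) (B : Fin n → ℕ → Carrier) i k →
                  iterate (λ k → sum λ m → x m * B m k) i k ≈ sum λ m → x m * iterate (B m) i k
    iterate-sum x B zero    k = refl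
    iterate-sum {n} x B (suc i) k = begin
      α k * iterate (λ k → sum λ m → x m * B m k) i k + β k * iterate (λ k → sum λ m → x m * B m k) i (suc k)
        ≈⟨ +-cong (*-congˡ (iterate-sum x B i k)) (*-congˡ (iterate-sum x B i (suc k))) ⟩
      α k * sum (λ m → x m * iterate (B m) i k) + β k * sum (λ m → x m * iterate (B m) i (suc k))
        ≈⟨ +-cong (*-distribˡ-sum (α k) (λ m → x m * iterate (B m) i k))
                  (*-distribˡ-sum (β k) (λ m → x m * iterate (B m) i (suc k))) ⟩
      sum (λ m → α k * (x m * iterate (B m) i k)) + sum (λ m → β k * (x m * iterate (B m) i (suc k)))
        ≈⟨ ∑-distrib-+ (λ m → α k * (x m * iterate (B m) i k)) (λ m → β k * (x m * iterate (B m) i (suc k))) ⟨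
      sum (λ m → α k * (x m * iterate (B m) i k) + β k * (x m * iterate (B m) i (suc k)))
        ≈⟨ sum-cong-≋ {n} (λ m → solve 5 (λ a b x y z → a :* (x :* y) :+ b :* (x :* z) := x :* (a :* y :+ b :* z)) refl
             (α k) (β k) (x m) (iterate (B m) i k) (iterate (B m) i (suc k))) ⟩
      sum (λ m → x m * (α k * iterate (B m) i k + β k * iterate (B m) i (suc k))) ∎

    -- Each step raises the index by at most one, so from k no index beyond i + k is reached.
    iterate-low : ∀ {g m} → (∀ {k} → k < m → g k ≈ 0#) → ∀ i k → i ℕ.+ k < m → iterate g i k ≈ 0#
    iterate-low g≈0 zero    k k<m = g≈0 k<m
    iterate-low {m = m} g≈0 (suc i) k lt = trans
      (+-cong (*-congˡ (iterate-low g≈0 i k (ℕ.<-trans ℕ.≤-refl lt)))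
              (*-congˡ (iterate-low g≈0 i (suc k) (≡.subst (_< m) (≡.sym (ℕ.+-suc i k)) lt))))
      (solve 2 (λ a b → a :* :0 :+ b :* :0 := :0) refl (α k) (β k))

    -- Index i + k is reached only by taking the `β` term in every step.
    iterate-lead : ∀ {g m} → (∀ {k} → k < m → g k ≈ 0#) → ∀ i k → i ℕ.+ k ≡ m →
                   iterate g i k ≈ product {i} (λ l → β (k ℕ.+ toℕ l)) * g m
    iterate-lead g≈0 zero    k ≡.refl = sym (*-identityˡ _)
    iterate-lead {g} {m} g≈0 (suc i) k eq = begin
      α k * iterate g i k + β k * iterate g i (suc k)
        ≈⟨ +-cong (*-congˡ (iterate-low g≈0 i k (ℕ.≤-reflexive eq)))
                  (*-congˡ (iterate-lead g≈0 i (suc k) (≡.trans (ℕ.+-suc i k) eq))) ⟩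
      α k * 0# + β k * (product {i} (λ l → β (suc k ℕ.+ toℕ l)) * g m)
        ≈⟨ solve 4 (λ a b p x → a :* :0 :+ b :* (p :* x) := b :* p :* x) refl (α k) (β k) _ (g m) ⟩
      β k * product {i} (λ l → β (suc k ℕ.+ toℕ l)) * g m
        ≈⟨ *-congʳ (*-cong (reflexive (≡.cong β (≡.sym (ℕ.+-identityʳ k))))
             (Π.sum-cong-≋ {i} λ l → reflexive (≡.cong β (≡.sym (ℕ.+-suc k (toℕ l)))))) ⟩
      β (k ℕ.+ 0) * product {i} (λ l → β (k ℕ.+ suc (toℕ l))) * g m ∎

-- Evaluation of the product of diagonal entries.

module Products {c ℓ : Level} (A : ℚ-Algebra c ℓ) where
  open PowerSeries A
  open ℚ-Solver A
  open Algebra.Properties.Semiring.Mult semiring using (×-congʳ; ×-assoc-*)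
  open Algebra.Properties.CommutativeSemiring.Exp commutativeSemiring
    using (^-distrib-*; ^-homo-*; ^-congˡ)
  private module Π = Algebra.Properties.CommutativeMonoid.Sum *-commutativeMonoid
  open Relation.Binary.Reasoning.Setoid setoid

  2# : Carrier
  2# = 1# + 1#

  product-last : ∀ n (f : ℕ → Carrier) → product {suc n} (f ∘ toℕ) ≈ product {n} (f ∘ toℕ) * f n
  product-last zero    f = *-comm _ _
  product-last (suc n) f = trans (*-congˡ (product-last n (f ∘ suc))) (sym (*-assoc _ _ _))

  product-scale : ∀ x n (f : ℕ → Carrier) → product {n} (λ l → x * f (toℕ l)) ≈ x ^ n * product {n} (f ∘ toℕ)
  product-scale x zero    f = sym (*-identityˡ 1#)
  product-scale x (suc n) f = trans (*-congˡ (product-scale x n (f ∘ suc)))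
    (solve 4 (λ a b c d → a :* b :* (c :* d) := a :* c :* (b :* d)) refl _ _ _ _)

  -- One factor `b` is taken from every power; the last exponent is 1 and drops to 0.
  product-staircase : ∀ N (b : ℕ → Carrier) →
    product {suc N} (λ j → b (toℕ j) ^ (suc N ∸ toℕ j))
      ≈ product {N} (λ j → b (toℕ j) ^ (N ∸ toℕ j)) * product {suc N} (b ∘ toℕ)
  product-staircase zero    b = solve 1 (λ x → x :* :1 :* :1 := :1 :* (x :* :1)) refl (b 0)
  product-staircase (suc N) b = trans (*-congˡ (product-staircase N (b ∘ suc)))
    (solve 4 (λ x y p q → x :* y :* (p :* q) := y :* p :* (x :* q)) refl (b 0) (b 0 ^ suc N) _ _)

  C₂-suc : ∀ N → suc (suc N) C 2 ≡ suc N ℕ.+ suc N C 2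
  C₂-suc N = ≡.trans (≡.sym (nCk+nC[k+1]≡[n+1]C[k+1] (suc N) 1)) (≡.cong (ℕ._+ suc N C 2) (nC1≡n (suc N)))

  -- The entry with m = N + 1 brings its factorial, a new row of the staircase, and 2^(N+1) twice,
  -- once from q and once from the recurrence. Together these powers are 4^(N+1), and N + 1 is the
  -- increment of the binomial coefficient.
  product-diagonal : ∀ N (b : ℕ → Carrier) →
    product {suc N} (λ m → (toℕ m !) × 2# ^ toℕ m * product {toℕ m} (λ l → 2# * b (toℕ l)))
      ≈ (4 × 1#) ^ (suc N C 2) * product {N} (λ i → (suc (toℕ i) !) × 1#) * product {N} (λ j → b (toℕ j) ^ (N ∸ toℕ j))
  product-diagonal zero b = solve 0 ((:1 :+ :0) :* :1 :* :1 := :1 :* :1 :* :1) refl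
  product-diagonal (suc N) b = begin
    product {2 ℕ.+ N} (d ∘ toℕ)
      ≈⟨ product-last (suc N) d ⟩
    product {suc N} (d ∘ toℕ) * d (suc N)
      ≈⟨ *-cong (product-diagonal N b) (*-cong n×2^n (product-scale 2# (suc N) b)) ⟩
    X * Y * Z * (F * T * (T * B))
      ≈⟨ solve 6 (λ x y z f t b → x :* y :* z :* (f :* t :* (t :* b)) := t :* t :* x :* (y :* f) :* (z :* b)) refl
           X Y Z F T B ⟩
    T * T * X * (Y * F) * (Z * B)
      ≈⟨ *-cong (*-cong fours (product-last N (λ i → (suc i !) × 1#))) (product-staircase N b) ⟨
    (4 × 1#) ^ (suc (suc N) C 2) * product {suc N} (λ i → (suc (toℕ i) !) × 1#)
      * product {suc N} (λ j → b (toℕ j) ^ (suc N ∸ toℕ j)) ∎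
    where
    d : ℕ → Carrier
    d m = (m !) × 2# ^ m * product {m} (λ l → 2# * b (toℕ l))
    X = (4 × 1#) ^ (suc N C 2)
    Y = product {N} (λ i → (suc (toℕ i) !) × 1#)
    Z = product {N} (λ j → b (toℕ j) ^ (N ∸ toℕ j))
    F = (suc N !) × 1#
    T = 2# ^ suc N
    B = product {suc N} (b ∘ toℕ)
    n×2^n : (suc N !) × T ≈ F * T
    n×2^n = sym (trans (×-assoc-* (suc N !) 1# T) (×-congʳ (suc N !) (*-identityˡ T)))
    fours : (4 × 1#) ^ (suc (suc N) C 2) ≈ T * T * X
    fours = begin
      (4 × 1#) ^ (suc (suc N) C 2)        ≡⟨ ≡.cong ((4 × 1#) ^_) (C₂-suc N) ⟩
      (4 × 1#) ^ (suc N ℕ.+ suc N C 2)    ≈⟨ ^-homo-* (4 × 1#) (suc N) (suc N C 2) ⟩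
      (4 × 1#) ^ suc N * X                ≈⟨ *-congʳ (^-congˡ (suc N) (solve 0
        (:1 :+ (:1 :+ (:1 :+ (:1 :+ :0))) := (:1 :+ :1) :* (:1 :+ :1)) refl)) ⟩
      (2# * 2#) ^ suc N * X               ≈⟨ *-congʳ (^-distrib-* 2# 2# (suc N)) ⟩
      T * T * X                           ∎

-- Factorisation of the dilated Hankel matrix.

module Hankel {c ℓ : Level} (A : ℚ-Algebra c ℓ) (s : ℚ-Algebra.Carrier A) where
  open PowerSeries A
  open ℚ-Solver A
  open SeriesRing A
  open Calculus A
  open Trigonometry A
  open Determinant A
  open Recurrences A
  open Products A
  open Algebra.Properties.CommutativeMonoid.Mult +-commutativeMonoid using (×-distrib-+)
  open Algebra.Properties.Semiring.Mult semiring
    using (×-congʳ; ×-comm-*; ×-assocˡ)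
  open Algebra.Properties.Semiring.Sum semiring using (sum-cong-≋)
  private module Π = Algebra.Properties.CommutativeMonoid.Sum *-commutativeMonoid
  open Relation.Binary.Reasoning.Setoid setoid

  egfCoeff-cong : ∀ {f g} → f ≋ g → ∀ k → egfCoeff f k ≈ egfCoeff g k
  egfCoeff-cong f≋g k = ×-congʳ (k !) (f≋g k)

  egfCoeff-∂ : ∀ f k → egfCoeff (∂ f) k ≈ egfCoeff f (suc k)
  egfCoeff-∂ f k = trans (×-assocˡ (f (suc k)) (k !) (suc k))
    (reflexive (≡.cong (_× f (suc k)) (ℕ.*-comm (k !) (suc k))))

  egfCoeff-linear : ∀ a f b g k → egfCoeff (a · f +ₛ b · g) k ≈ a * egfCoeff f k + b * egfCoeff g k
  egfCoeff-linear a f b g k = trans (×-distrib-+ (a * f k) (b * g k) (k !))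
    (+-cong (sym (×-comm-* (k !) a (f k))) (sym (×-comm-* (k !) b (g k))))

  -- `α` is written through `t (suc k)`, although `t-suc` reduces its base to t k + 1, so that it
  -- matches `∂²-vE` at r = `t (suc k)`.
  σ t α β γ : ℕ → Carrier
  σ k = s + (2 ℕ.* k) × 1#
  t k = - σ k
  α k = - ((t (suc k) + 1# + 1# + 1#) * (t (suc k) + 1# + 1# + 1#))
  γ k = σ k * (σ k + 1#)
  β k = 2# * γ k

  open Iterate α β

  F : ℕ → Series
  F k = v *ₛ E (t k)

  t-suc : ∀ k → t (suc k) + 1# + 1# ≈ t k
  t-suc k = trans (+-congʳ (+-congʳ (-‿cong (+-congˡ (reflexive (≡.cong (_× 1#) (ℕ.*-suc 2 k)))))))
    (solve 2 (λ s x → :- (s :+ (:1 :+ (:1 :+ x))) :+ :1 :+ :1 := :- (s :+ x)) refl s ((2 ℕ.* k) × 1#))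

  F-suc : ∀ k → v *ₛ E (t (suc k) + 1# + 1#) ≋ F k
  F-suc k = *ₛ-cong {v} (λ _ → refl) (E-cong (t-suc k))

  ∂²-F : ∀ k → ∂ (∂ (F k)) ≋ α k · F k +ₛ β k · F (suc k)
  ∂²-F k i = begin
    ∂ (∂ (F k)) i
      ≈⟨ ∂-cong (∂-cong (F-suc k)) i ⟨
    ∂ (∂ (v *ₛ E (r + 1# + 1#))) i
      ≈⟨ ∂²-vE r i ⟩
    α k * (v *ₛ E (r + 1# + 1#)) i + 2# * ((r + 1# + 1#) * (r + 1#)) * F (suc k) i
      ≈⟨ +-cong (*-congˡ (F-suc k i)) (*-congʳ (*-congˡ β≈)) ⟩
    α k * F k i + β k * F (suc k) i ∎
    where
    r = t (suc k)
    β≈ : (r + 1# + 1#) * (r + 1#) ≈ γ k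
    β≈ = begin
      (r + 1# + 1#) * (r + 1#)
        ≈⟨ *-congˡ (solve 1 (λ r → r :+ :1 := r :+ :1 :+ :1 :- :1) refl r) ⟩
      (r + 1# + 1#) * (r + 1# + 1# - 1#)
        ≈⟨ *-cong (t-suc k) (+-congʳ (t-suc k)) ⟩
      t k * (t k - 1#)
        ≈⟨ solve 1 (λ σ → (:- σ) :* ((:- σ) :- :1) := σ :* (σ :+ :1)) refl (σ k) ⟩
      γ k ∎

  egfCoeff-iterate : ∀ i j k → egfCoeff (F k) (2 ℕ.* i ℕ.+ j) ≈ iterate (λ k → egfCoeff (F k) j) i k
  egfCoeff-iterate zero    j k = refl
  egfCoeff-iterate (suc i) j k = begin
    egfCoeff (F k) (2 ℕ.* suc i ℕ.+ j)
      ≡⟨ ≡.cong (λ x → egfCoeff (F k) (x ℕ.+ j)) (ℕ.*-suc 2 i) ⟩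
    egfCoeff (F k) (2 ℕ.+ l)
      ≈⟨ egfCoeff-∂ (F k) (suc l) ⟨
    egfCoeff (∂ (F k)) (suc l)
      ≈⟨ egfCoeff-∂ (∂ (F k)) l ⟨
    egfCoeff (∂ (∂ (F k))) l
      ≈⟨ egfCoeff-cong (∂²-F k) l ⟩
    egfCoeff (α k · F k +ₛ β k · F (suc k)) l
      ≈⟨ egfCoeff-linear (α k) (F k) (β k) (F (suc k)) l ⟩
    α k * egfCoeff (F k) l + β k * egfCoeff (F (suc k)) l
      ≈⟨ +-cong (*-congˡ (egfCoeff-iterate i j k)) (*-congˡ (egfCoeff-iterate i j (suc k))) ⟩
    iterate (λ k → egfCoeff (F k) j) (suc i) k ∎
    where l = 2 ℕ.* i ℕ.+ j

  -- The exponent has index p + k because the p-th difference involves F_k, ..., F_{k+p}, whose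
  -- common factor is the power of `u` in the last one.
  difference : ℕ → ℕ → ℕ → Carrier
  difference j p k = egfCoeff (G (t (p ℕ.+ k)) p) j

  difference-step : ∀ j p k → difference j p (suc k) ≈ difference j p k + difference j (suc p) k
  difference-step j p k = begin
    (j !) × G (t (p ℕ.+ suc k)) p j
      ≡⟨ ≡.cong (λ i → (j !) × G (t i) p j) (ℕ.+-suc p k) ⟩
    (j !) × G r p j
      ≈⟨ ×-congʳ (j !) (G-split r p j) ⟩
    (j !) × (G (r + 1# + 1#) p j + G r (suc p) j)
      ≈⟨ ×-congʳ (j !) (+-congʳ (*ₛ-cong {q ^ₛ p} (λ _ → refl) (F-suc (p ℕ.+ k)) j)) ⟩
    (j !) × (G (t (p ℕ.+ k)) p j + G r (suc p) j)
      ≈⟨ ×-distrib-+ _ _ (j !) ⟩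
    difference j p k + difference j (suc p) k ∎
    where r = t (suc (p ℕ.+ k))

  difference-low : ∀ {j} p k → j < p → difference j p k ≈ 0#
  difference-low {j} p k j<p = trans (×-congʳ (j !) (G-low (t (p ℕ.+ k)) p j<p)) (×0# (j !))

  -- Stated up to `≋` because the exponent of `F 0` is -(s + 0), not literally -s.
  dilatedHankel-F : ∀ n {g} → g ≋ F 0 → dilatedHankel n g
    ≈ product {n} λ m → (toℕ m !) × 2# ^ toℕ m * product {toℕ m} (λ l → 2# * γ (toℕ l))
  dilatedHankel-F n {g} g≋ = begin
    dilatedHankel n g
      ≈⟨ det-minor 0 (λ i j → egfCoeff g (2 ℕ.* toℕ i ℕ.+ toℕ j)) f (λ i j →
           trans (egfCoeff-cong g≋ (2 ℕ.* toℕ i ℕ.+ toℕ j)) (egfCoeff-iterate (toℕ i) (toℕ j) 0)) ⟩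
    minor n 0 (tabulate f)
      ≈⟨ minor-LU 0 f P Q f≈ P-low (λ m j j<m → difference-low (toℕ m) 0 j<m) ⟩
    product (λ m → Q m m * P m (toℕ m))
      ≈⟨ Π.sum-cong-≋ {n} (λ m → *-cong (×-congʳ (toℕ m !) (G-lead (t (toℕ m ℕ.+ 0)) (toℕ m))) (P-lead m)) ⟩
    product {n} (λ m → (toℕ m !) × 2# ^ toℕ m * product {toℕ m} (λ l → 2# * γ (toℕ l))) ∎
    where
    f P : Fin n → Column
    f j i = iterate (λ k → egfCoeff (F k) (toℕ j)) i 0
    P m i = iterate (λ k → choose k (toℕ m)) i 0

    Q : Fin n → Fin n → Carrier
    Q m j = difference (toℕ j) (toℕ m) 0

    newton-F : ∀ (j : Fin n) k → egfCoeff (F k) (toℕ j) ≈ sum λ m → Q m j * choose k (toℕ m)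
    newton-F j k = begin
      egfCoeff (F k) (toℕ j)
        ≈⟨ egfCoeff-cong (λ i → sym (*ₛ-identityˡ (F k) i)) (toℕ j) ⟩
      difference (toℕ j) 0 k
        -- Column indices are below n, so differences of order n and higher vanish and n terms
        -- suffice for every k.
        ≈⟨ newton (difference (toℕ j)) (difference-step (toℕ j))
             (λ p k n≤p → difference-low p k (ℕ.<-≤-trans (toℕ<n j) n≤p)) n 0 (ℕ.m≤m+n n 0) k ⟩
      sum {n} (λ m → choose k (toℕ m) * difference (toℕ j) (toℕ m ℕ.+ 0) 0)
        ≈⟨ sum-cong-≋ {n} (λ m → trans (*-comm (choose k (toℕ m)) _)
             (*-congʳ (reflexive (≡.cong (λ p → difference (toℕ j) p 0) (ℕ.+-identityʳ (toℕ m)))))) ⟩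
      sum (λ m → Q m j * choose k (toℕ m)) ∎

    f≈ : ∀ j i → f j i ≈ sum λ m → Q m j * P m i
    -- The recurrence is linear and acts on k only, so Newton's formula may be substituted under it
    -- and the coefficients `Q m j` pulled out.
    f≈ j i = trans (iterate-cong (newton-F j) i 0)
      (iterate-sum (λ m → Q m j) (λ m k → choose k (toℕ m)) i 0)

    P-low : ∀ m {i} → i < toℕ m → P m i ≈ 0#
    P-low m {i} i<m = iterate-low {λ k → choose k (toℕ m)} choose-low i 0
      (≡.subst (_< toℕ m) (≡.sym (ℕ.+-identityʳ i)) i<m)

    P-lead : ∀ m → P m (toℕ m) ≈ product {toℕ m} (λ l → 2# * γ (toℕ l))
    P-lead m = trans (iterate-lead {λ k → choose k (toℕ m)} choose-low (toℕ m) 0 (ℕ.+-identityʳ (toℕ m)))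
      (trans (*-congˡ (choose-diag (toℕ m))) (*-identityʳ _))

theorem17p1 : {c ℓ : Level} (A : ℚ-Algebra c ℓ) → let open PowerSeries A in
    (n : ℕ) → n ≥ 1 → (s : Carrier) →
    dilatedHankel n ((cosₛ +ₛ sinₛ) *ₛ (cosₛ -ₛ sinₛ) ^^ (- s))
    ≈ (4 × 1#) ^ (n C 2)
    * product {n ∸ 1} (λ i → (suc (toℕ i) !) × 1#)
    * product {n ∸ 1} (λ j →
    ((s + (2 ℕ.* toℕ j) × 1#) * (s + (2 ℕ.* toℕ j) × 1# + 1#)) ^ (n ∸ 1 ∸ toℕ j))
theorem17p1 A (suc N) _ s = trans
  (dilatedHankel-F (suc N) (*ₛ-cong {v} (λ _ → refl) (E-cong (-‿cong (sym (+-identityʳ s))))))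
  (product-diagonal N γ)
  where
  open PowerSeries A
  open SeriesRing A
  open Trigonometry A
  open Products A
  open Hankel A s
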